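{- Let $a,b\ge 1$, let $\rho$ be the canonical sequential form of a non-crossing partition of length $m$ for some $m\ge 1$, and let $\tau=1^a(\rho+1)1^b$. Put $s=\min\{a,b\}$ and $t=\max\{a,b\}$. Then the generating function $\sum_{n\ge 0}\big(\sum_{\pi\in NC_n}q^{\mu_\tau(\pi)}\big)x^n$ counting the members of $NC_n$ for $n\ge 0$ according to the number of occurrences of the subword $\tau$ is $$\frac{\left(1-x+(1-q)(1-x^s)x^{m+t}\right)\left(1-\sqrt{1-\frac{4x(1-x+(1-q)(1-x^{s-1})x^{m+t})}{1-x+(1-q)(1-x^s)x^{m+t}}}\right)}{2x\left(1-x+(1-q)(1-x^{s-1})x^{m+t}\right)}.$$
   Context: A set partition of $[n]=\{1,\dots,n\}$ with blocks $B_1,\dots,B_k$ ordered so that $\min B_1<\cdots<\min B_k$ is represented by its canonical sequential form $\pi=\pi_1\cdots\pi_n$, where $i\in B_{\pi_i}$ for each $i$; $n$ is its length. It is non-crossing if $\pi$ contains no (not necessarily consecutive) subsequence of the form $a\,b\,a\,b$ with $a<b$. $NC_n$ denotes the set of non-crossing partitions of $[n]$, identified with their canonical sequential forms ($NC_0$ consists of the empty partition). A subword pattern is a finite sequence $\tau=\tau_1\cdots\tau_k$ of positive integers whose set of distinct letters is $[\ell]$ for some $\ell$. An occurrence of $\tau$ in a sequence $\sigma_1\cdots\sigma_n$ is an index $i\in[n-k+1]$ such that the string of consecutive letters $\sigma_i\cdots\sigma_{i+k-1}$ is order-isomorphic to $\tau$ (same relative order, including equalities). $\mu_\tau(\pi)$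 denotes the number of occurrences of $\tau$ in $\pi$. $\rho+1$ is the sequence obtained by adding $1$ to each entry of $\rho$, $1^a$ is the word of $a$ ones, and juxtaposition is concatenation. The formula is an identity of formal power series in $x$ (over $\mathbb{Q}(q)$), the square root being the one with constant term $1$. -}

module Defs where

open import Algebra.Bundles using (RawRing)
import Algebra.Definitions.RawSemiring as RawSemiringDefinitions
import Algebra.Properties.CommutativeMonoid.Sum as MonoidSum
import Algebra.Apartness.Properties.HeytingCommutativeRing as Heyting
open import Data.Bool.Base using (true)
open import Data.Fin.Base as Fin using (Fin; toℕ; fromℕ<)
import Data.Fin.Properties as Fin
open import Data.Fin.Subset using (Subset; Nonempty) renaming (_∈_ to _∈ₛ_)
open import Data.Fin.Subset.Properties using () renaming (_∈?_ to _∈ₛ?_)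
open import Data.List.Base using (List; []; _∷_; map; length; lookup; filter; zip; take; drop; upTo; foldr; cartesianProductWith)
open import Data.List.Properties using (∷-injective)
open import Data.List.Membership.Propositional using (_∈_; find; lose)
open import Data.List.Membership.Propositional.Properties using (∈-cartesianProductWith⁺; ∈-map⁺; ∈-upTo⁺; ∈-filter⁺; ∈-filter⁻)
open import Data.List.Relation.Unary.All as All using (All; [])
open import Data.List.Relation.Unary.Any as Any using (here)
open import Data.List.Relation.Unary.AllPairs as AllPairs using ()
open import Data.List.Relation.Unary.Unique.Propositional using (Unique)
import Data.List.Relation.Unary.Unique.Propositional.Properties as Unique
open import Data.List.Relation.Binary.Sublist.Propositional using (_⊆_; to∈)
open import Data.List.Relation.Binary.Sublist.Heterogeneous.Properties using (∷ˡ⁻)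
open import Data.List.Relation.Binary.Sublist.DecPropositional using (_⊆?_)
open import Data.Nat.Base using (ℕ; zero; suc; pred; _+_; _∸_; _⊔_; _≤_; _<_; z≤n; s≤s; s≤s⁻¹; >-nonZero)
import Data.Nat.Properties as ℕ
open import Data.Product.Base using (Σ; ∃; ∃₂; _×_; _,_; proj₁; proj₂)
open import Data.Rational.Base as ℚ using (ℚ; 0ℚ)
import Data.Rational.Properties as ℚ
open import Data.Sum.Base using (_⊎_; inj₁; inj₂)
open import Data.Vec.Base as Vec using (tabulate)
import Data.Vec.Properties as Vec
import Data.Vec.Functional as Vector
open import Function.Base using (_∘_)
open import Function.Bundles using (_⇔_; mk⇔)
open import Level using (0ℓ) renaming (_⊔_ to _⊔ˡ_)
open import Relation.Binary.Definitions using (tri<; tri≈; tri>)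
open import Relation.Binary.PropositionalEquality using (_≡_; _≢_; refl; sym; trans; cong; cong₂; subst)
open import Relation.Nullary using (¬_; Dec; yes; no; does; contradiction)
open import Relation.Nullary.Decidable using (_×-dec_; _→-dec_; ¬?; map′; decidable-stable; dec-true)

-- Positions are indexed from 0: i : Fin n is the element i + 1 of [n], and
-- j : Fin k indexes the block B_(j+1).

IsMinimum : ∀ {n} → Subset n → Fin n → Set
IsMinimum B i = i ∈ₛ B × (∀ {i′} → i′ ∈ₛ B → i Fin.≤ i′)

record SetPartition (n k : ℕ) : Set where
  field
    block    : Fin k → Subset n
    nonempty : ∀ j → Nonempty (block j)
    disjoint : ∀ {i j j′} → i ∈ₛ block j → i ∈ₛ block j′ → j ≡ j′
    covering : ∀ i → ∃ λ j → i ∈ₛ block j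
    ordered  : ∀ {i i′ j j′} → j Fin.< j′ →
               IsMinimum (block j) i → IsMinimum (block j′) i′ → i Fin.< i′

open SetPartition

Represents : ∀ {k} (π : List ℕ) → SetPartition (length π) k → Set
Represents π P = ∀ i → ∃ λ j → lookup π i ≡ suc (toℕ j) × i ∈ₛ block P j

IsCanonicalForm : List ℕ → Set
IsCanonicalForm π = ∃ λ k → Σ (SetPartition (length π) k) (Represents π)

NonCrossing : List ℕ → Set
NonCrossing π = ¬ (∃₂ λ a b → a < b × (a ∷ b ∷ a ∷ b ∷ []) ⊆ π)

record IsNC (n : ℕ) (π : List ℕ) : Set where
  constructor isNC
  field
    length≡n    : length π ≡ n
    canonical   : IsCanonicalForm π
    nonCrossing : NonCrossing π

open IsNC

-- An equivalent condition (see canonical⇒growth, growth⇒canonical) used only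
-- to decide IsCanonicalForm: all letters are positive, and every positive
-- letter smaller than π_i occurs to the left of position i.
RestrictedGrowth : List ℕ → Set
RestrictedGrowth π = ∀ i → 1 ≤ lookup π i ×
  (∀ (c : Fin (pred (lookup π i))) → ∃ λ i′ → i′ Fin.< i × lookup π i′ ≡ suc (toℕ c))

restrictedGrowth? : ∀ π → Dec (RestrictedGrowth π)
restrictedGrowth? π = Fin.all? λ i → (1 ℕ.≤? lookup π i) ×-dec
  (Fin.all? λ c → Fin.any? λ i′ → (i′ Fin.<? i) ×-dec (lookup π i′ ℕ.≟ suc (toℕ c)))

private

  minimum : ∀ {n} (B : Subset n) → Nonempty B → ∃ (IsMinimum B)
  minimum {n} B (e , e∈B)
    with i , ¬¬i∈B , below ← Fin.¬∀⟶∃¬-smallest n (λ i → ¬ (i ∈ₛ B)) (λ i → ¬? (i ∈ₛ? B)) (λ none → none e e∈B)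
    = i , decidable-stable (i ∈ₛ? B) ¬¬i∈B , λ {i′} i′∈B → ℕ.≮⇒≥ λ i′<i →
        below (fromℕ< i′<i)
          (subst (_∈ₛ B)
            (Fin.toℕ-injective (sym (trans (Fin.toℕ-inject (fromℕ< i′<i)) (Fin.toℕ-fromℕ< i′<i))))
            i′∈B)

canonical⇒growth : ∀ π → IsCanonicalForm π → RestrictedGrowth π
canonical⇒growth π (k , P , rep) i with rep i
... | j , πᵢ≡ , i∈Bⱼ = subst (1 ≤_) (sym πᵢ≡) (s≤s z≤n) , earlier
  where
  earlier : (c : Fin (pred (lookup π i))) → ∃ λ i′ → i′ Fin.< i × lookup π i′ ≡ suc (toℕ c)
  earlier c = i′ , ℕ.<-≤-trans (ordered P j′<j min′ min) (proj₂ min i∈Bⱼ) , πᵢ′≡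
    where
    c<j : toℕ c < toℕ j
    c<j = subst (toℕ c <_) (cong pred πᵢ≡) (Fin.toℕ<n c)
    c<k = ℕ.<-trans c<j (Fin.toℕ<n j)
    j′ = fromℕ< c<k
    j′<j : j′ Fin.< j
    j′<j = subst (_< toℕ j) (sym (Fin.toℕ-fromℕ< c<k)) c<j
    i′ = proj₁ (minimum (block P j′) (nonempty P j′))
    min′ = proj₂ (minimum (block P j′) (nonempty P j′))
    min = proj₂ (minimum (block P j) (nonempty P j))
    πᵢ′≡ : lookup π i′ ≡ suc (toℕ c)
    πᵢ′≡ with rep i′
    ... | j″ , eq , i′∈B = trans eq (cong suc (trans (cong toℕ (disjoint P i′∈B (proj₁ min′))) (Fin.toℕ-fromℕ< c<k)))

private

  largest : ∀ π → foldr _⊔_ 0 π ≡ 0 ⊎ ∃ λ i → lookup π i ≡ foldr _⊔_ 0 π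
  largest [] = inj₁ refl
  largest (x ∷ π) with ℕ.⊔-sel x (foldr _⊔_ 0 π)
  ... | inj₁ eq = inj₂ (Fin.zero , sym eq)
  ... | inj₂ eq with largest π
  ...   | inj₁ z = inj₁ (trans eq z)
  ...   | inj₂ (i , eq′) = inj₂ (Fin.suc i , trans eq′ (sym eq))

  ≤-largest : ∀ π i → lookup π i ≤ foldr _⊔_ 0 π
  ≤-largest (x ∷ π) Fin.zero = ℕ.m≤m⊔n x _
  ≤-largest (x ∷ π) (Fin.suc i) = ℕ.≤-trans (≤-largest π i) (ℕ.m≤n⊔m x _)

  does⇒ : ∀ {A : Set} (A? : Dec A) → does A? ≡ true → A
  does⇒ (yes a) _ = a

growth⇒canonical : ∀ π → RestrictedGrowth π → IsCanonicalForm π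
growth⇒canonical π rg = k , P , rep
  where
  k = foldr _⊔_ 0 π

  B : Fin k → Subset (length π)
  B j = tabulate λ i → does (lookup π i ℕ.≟ suc (toℕ j))

  ∈B : ∀ {i} j → lookup π i ≡ suc (toℕ j) → i ∈ₛ B j
  ∈B {i} j eq = Vec.lookup⇒[]= i (B j)
    (trans (Vec.lookup∘tabulate _ i) (dec-true (lookup π i ℕ.≟ suc (toℕ j)) eq))

  B∋ : ∀ {i} j → i ∈ₛ B j → lookup π i ≡ suc (toℕ j)
  B∋ {i} j i∈ = does⇒ (lookup π i ℕ.≟ suc (toℕ j)) (trans (sym (Vec.lookup∘tabulate _ i)) (Vec.[]=⇒lookup i∈))

  before : ∀ i {c} → suc c < lookup π i → ∃ λ i′ → i′ Fin.< i × lookup π i′ ≡ suc c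
  before i {c} c<πᵢ
    with i′ , i′<i , eq ← proj₂ (rg i) (fromℕ< (ℕ.pred-mono-≤ c<πᵢ))
    = i′ , i′<i , trans eq (cong suc (Fin.toℕ-fromℕ< _))

  rep : ∀ i → ∃ λ j → lookup π i ≡ suc (toℕ j) × i ∈ₛ B j
  rep i = j , eq , ∈B j eq
    where
    suc-pred : suc (pred (lookup π i)) ≡ lookup π i
    suc-pred = ℕ.suc-pred (lookup π i) {{>-nonZero (proj₁ (rg i))}}
    <k : pred (lookup π i) < k
    <k = subst (_≤ k) (sym suc-pred) (≤-largest π i)
    j = fromℕ< <k
    eq : lookup π i ≡ suc (toℕ j)
    eq = trans (sym suc-pred) (cong suc (sym (Fin.toℕ-fromℕ< <k)))

  nonempty′ : ∀ j → Nonempty (B j)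
  nonempty′ j with largest π
  ... | inj₁ k≡0 = contradiction (subst Fin k≡0 j) λ ()
  ... | inj₂ (i , πᵢ≡k) with ℕ.m≤n⇒m<n∨m≡n (subst (suc (toℕ j) ≤_) (sym πᵢ≡k) (Fin.toℕ<n j))
  ...   | inj₂ eq = i , ∈B j (sym eq)
  ...   | inj₁ lt with i′ , _ , eq ← before i lt = i′ , ∈B j eq

  P : SetPartition (length π) k
  P .block = B
  P .nonempty = nonempty′
  P .disjoint {j = j} {j′ = j′} i∈ i∈′ =
    Fin.toℕ-injective (ℕ.suc-injective (trans (sym (B∋ j i∈)) (B∋ j′ i∈′)))
  P .covering i = let j , _ , i∈ = rep i in j , i∈
  P .ordered {i′ = i′} {j = j} {j′ = j′} j<j′ (_ , below) (i′∈ , _)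
    with i″ , i″<i′ , eq ← before i′ (subst (suc (toℕ j) <_) (sym (B∋ j′ i′∈)) (s≤s j<j′))
    = ℕ.≤-<-trans (below (∈B j eq)) i″<i′

canonical? : ∀ π → Dec (IsCanonicalForm π)
canonical? π = map′ (growth⇒canonical π) (canonical⇒growth π) (restrictedGrowth? π)

nonCrossing? : ∀ π → Dec (NonCrossing π)
nonCrossing? π = ¬? (map′ to from (Any.any? (λ a → Any.any? (abab? a) π) π))
  where
  ABAB : ℕ → ℕ → Set
  ABAB a b = a < b × (a ∷ b ∷ a ∷ b ∷ []) ⊆ π

  abab? : ∀ a b → Dec (ABAB a b)
  abab? a b = (a ℕ.<? b) ×-dec (_⊆?_ ℕ._≟_ (a ∷ b ∷ a ∷ b ∷ []) π)

  to : Any.Any (λ a → Any.Any (ABAB a) π) π → ∃₂ ABAB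
  to some with a , _ , some′ ← find some with b , _ , abab ← find some′ = a , b , abab

  from : ∃₂ ABAB → Any.Any (λ a → Any.Any (ABAB a) π) π
  from (a , b , a<b , sub) = lose (to∈ sub) (lose (to∈ (∷ˡ⁻ sub)) (a<b , sub))

isNC? : ∀ n π → Dec (IsNC n π)
isNC? n π = map′ (λ (l , c , x) → isNC l c x) (λ (isNC l c x) → l , c , x)
  ((length π ℕ.≟ n) ×-dec (canonical? π ×-dec nonCrossing? π))

words : List ℕ → ℕ → List (List ℕ)
words alphabet zero = [] ∷ []
words alphabet (suc n) = cartesianProductWith _∷_ alphabet (words alphabet n)

-- Letters are block numbers, so they are at most n; see ∈-NC.
NC : ℕ → List (List ℕ)
NC n = filter (isNC? n) (words (map suc (upTo n)) n)

private

  ∈-words : ∀ {alphabet} π → (∀ i → lookup π i ∈ alphabet) → π ∈ words alphabet (length π)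
  ∈-words [] _ = here refl
  ∈-words (x ∷ π) all = ∈-cartesianProductWith⁺ _∷_ (all Fin.zero) (∈-words π (all ∘ Fin.suc))

  blocks≤n : ∀ {n k} → SetPartition n k → k ≤ n
  blocks≤n P = Fin.injective⇒≤ {f = λ j → proj₁ (nonempty P j)} λ {j} {j′} eq →
    disjoint P (proj₂ (nonempty P j)) (subst (_∈ₛ block P j′) (sym eq) (proj₂ (nonempty P j′)))

  letters : ∀ π → IsCanonicalForm π → ∀ i → lookup π i ∈ map suc (upTo (length π))
  letters π (k , P , rep) i with rep i
  ... | j , eq , _ = subst (_∈ _) (sym eq)
    (∈-map⁺ suc (∈-upTo⁺ (ℕ.<-≤-trans (Fin.toℕ<n j) (blocks≤n P))))

  words-unique : ∀ {alphabet} → Unique alphabet → ∀ n → Unique (words alphabet n)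
  words-unique u zero = [] AllPairs.∷ AllPairs.[]
  words-unique u (suc n) = Unique.cartesianProductWith⁺ _∷_ ∷-injective u (words-unique u n)

∈-NC : ∀ {n π} → π ∈ NC n ⇔ IsNC n π
∈-NC {n} {π} = mk⇔ (proj₂ ∘ ∈-filter⁻ (isNC? n) {xs = words (map suc (upTo n)) n}) λ where
  p@(isNC refl c _) → ∈-filter⁺ (isNC? n) (∈-words π (letters π c)) p

NC-unique : ∀ n → Unique (NC n)
NC-unique n = Unique.filter⁺ (isNC? n)
  (words-unique (Unique.map⁺ ℕ.suc-injective (Unique.upTo⁺ n)) n)

SameOrder : ℕ × ℕ → ℕ × ℕ → Set
SameOrder (x , y) (x′ , y′) =
  ((x < x′ → y < y′) × (y < y′ → x < x′)) × ((x ≡ x′ → y ≡ y′) × (y ≡ y′ → x ≡ x′))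

sameOrder? : ∀ p p′ → Dec (SameOrder p p′)
sameOrder? (x , y) (x′ , y′) =
  (((x ℕ.<? x′) →-dec (y ℕ.<? y′)) ×-dec ((y ℕ.<? y′) →-dec (x ℕ.<? x′))) ×-dec
  (((x ℕ.≟ x′) →-dec (y ℕ.≟ y′)) ×-dec ((y ℕ.≟ y′) →-dec (x ℕ.≟ x′)))

OrderIsomorphic : List ℕ → List ℕ → Set
OrderIsomorphic u v =
  length u ≡ length v × All (λ p → All (SameOrder p) (zip u v)) (zip u v)

orderIsomorphic? : ∀ u v → Dec (OrderIsomorphic u v)
orderIsomorphic? u v = (length u ℕ.≟ length v) ×-dec
  All.all? (λ p → All.all? (sameOrder? p) (zip u v)) (zip u v)

-- Starting indices are counted from 0, so they range over 0, …, |σ| - |τ|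
-- (no index at all if |σ| < |τ|).
μ : List ℕ → List ℕ → ℕ
μ τ σ = length (filter (λ i → orderIsomorphic? (take (length τ) (drop i σ)) τ)
                       (upTo (suc (length σ) ∸ length τ)))

module PowerSeries {c ℓ} (R : RawRing c ℓ) where

  private
    module R = RawRing R
  open RawSemiringDefinitions R.rawSemiring using (sum)

  Series : Set c
  Series = ℕ → R.Carrier

  constant : R.Carrier → Series
  constant r zero = r
  constant r (suc _) = R.0#

  rawRing : RawRing c ℓ
  rawRing = record
    { Carrier = Series
    ; _≈_ = λ f g → ∀ n → f n R.≈ g n
    ; _+_ = λ f g n → f n R.+ g n
    ; _*_ = λ f g n → sum {suc n} (λ k → f (toℕ k) R.* g (n ∸ toℕ k))
    ; -_ = λ f n → R.- f n
    ; 0# = λ _ → R.0#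
    ; 1# = constant R.1#
    }

  open RawRing rawRing public using (_≈_; _≉_; _*_; -_; 0#; 1#)
    renaming (_+_ to infixl 6 _⊕_)
  open RawSemiringDefinitions (RawRing.rawSemiring rawRing) public
    using (_^_) renaming (_×_ to _·_)

  infixl 6 _⊖_
  _⊖_ : Series → Series → Series
  f ⊖ g = f ⊕ - g

  X : Series
  X zero = R.0#
  X (suc zero) = R.1#
  X (suc (suc _)) = R.0#

  -- f = g / h.  When R is a domain there is at most one such f, as h ≉ 0.
  IsQuotient : Series → Series → Series → Set ℓ
  IsQuotient f g h = h ≉ 0# × f * h ≈ g

  -- s = √g with constant term 1.  When R is a domain with 2 ≉ 0 there is
  -- at most one such s.
  IsSquareRoot : Series → Series → Set ℓ
  IsSquareRoot s g = s * s ≈ g × s 0 R.≈ R.1#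

module Fractions {c ℓ} (R : RawRing c ℓ)
  (1≉0 : RawRing._≉_ R (RawRing.1# R) (RawRing.0# R))
  (*-≉0 : ∀ x y → RawRing._≉_ R x (RawRing.0# R) → RawRing._≉_ R y (RawRing.0# R) →
          RawRing._≉_ R (RawRing._*_ R x y) (RawRing.0# R)) where

  open RawRing R using (Carrier; _≈_; _≉_; _*_; -_; 0#; 1#) renaming (_+_ to _+ᴿ_)

  record Fraction : Set (c ⊔ˡ ℓ) where
    constructor fraction
    field
      num   : Carrier
      den   : Carrier
      den≉0 : den ≉ 0#

  open Fraction

  fromBase : Carrier → Fraction
  fromBase r = fraction r 1# 1≉0

  fractionRawRing : RawRing (c ⊔ˡ ℓ) ℓ
  fractionRawRing = record
    { Carrier = Fraction
    ; _≈_ = λ x y → num x * den y ≈ num y * den x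
    ; _+_ = λ x y → fraction (num x * den y +ᴿ num y * den x) (den x * den y)
        (*-≉0 (den x) (den y) (den≉0 x) (den≉0 y))
    ; _*_ = λ x y → fraction (num x * num y) (den x * den y)
        (*-≉0 (den x) (den y) (den≉0 x) (den≉0 y))
    ; -_ = λ x → fraction (- num x) (den x) (den≉0 x)
    ; 0# = fromBase 0#
    ; 1# = fromBase 1#
    }

private
  module ℚ⟦q⟧ = PowerSeries ℚ.+-*-rawRing

-- A polynomial is a power series all of whose coefficients from some
-- index on are zero.
record Polynomial : Set where
  constructor polynomial
  field
    coeff  : ℕ → ℚ
    bound  : ℕ
    vanish : ∀ n → bound ≤ n → coeff n ≡ 0ℚ

open Polynomial

private

  open MonoidSum ℚ.+-0-commutativeMonoid using (sum; sum-cong-≗; sum-remove; sum-replicate-zero)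

  sum-zero : ∀ {n} (v : Vector.Vector ℚ n) → (∀ k → v k ≡ 0ℚ) → sum v ≡ 0ℚ
  sum-zero {n} v v≡0 = trans (sum-cong-≗ v≡0) (sum-replicate-zero n)

  sum-single : ∀ {n} (v : Vector.Vector ℚ n) k → (∀ k′ → k′ ≢ k → v k′ ≡ 0ℚ) → sum v ≡ v k
  sum-single {suc n} v k rest = trans (sum-remove {i = k} v)
    (trans (cong (v k ℚ.+_) (sum-zero _ λ j → rest _ (Fin.punchInᵢ≢i k j))) (ℚ.+-identityʳ (v k)))

  *-vanish : ∀ (f g : Polynomial) n → bound f + bound g ≤ n → (coeff f ℚ⟦q⟧.* coeff g) n ≡ 0ℚ
  *-vanish f g n b≤n = sum-zero _ term
    where
    term : ∀ (k : Fin (suc n)) → coeff f (toℕ k) ℚ.* coeff g (n ∸ toℕ k) ≡ 0ℚ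
    term k with bound f ℕ.≤? toℕ k
    ... | yes b≤k = trans (cong (ℚ._* coeff g _) (vanish f _ b≤k)) (ℚ.*-zeroˡ (coeff g _))
    ... | no b≰k = trans (cong (coeff f (toℕ k) ℚ.*_) (vanish g _
            (ℕ.m+n≤o⇒m≤o∸n (bound g) (ℕ.≤-trans (ℕ.+-monoʳ-≤ (bound g) (ℕ.<⇒≤ (ℕ.≰⇒> b≰k)))
              (subst (_≤ n) (ℕ.+-comm (bound f) (bound g)) b≤n)))))
            (ℚ.*-zeroʳ (coeff f (toℕ k)))

ℚ[q] : RawRing 0ℓ 0ℓ
ℚ[q] = record
  { Carrier = Polynomial
  ; _≈_ = λ f g → coeff f ℚ⟦q⟧.≈ coeff g
  ; _+_ = λ f g → polynomial (coeff f ℚ⟦q⟧.⊕ coeff g) (bound f ⊔ bound g) λ n b≤n →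
      cong₂ ℚ._+_ (vanish f n (ℕ.m⊔n≤o⇒m≤o _ _ b≤n)) (vanish g n (ℕ.m⊔n≤o⇒n≤o _ _ b≤n))
  ; _*_ = λ f g → polynomial (coeff f ℚ⟦q⟧.* coeff g) (bound f + bound g) (*-vanish f g)
  ; -_ = λ f → polynomial (ℚ⟦q⟧.- coeff f) (bound f) λ n b≤n → cong ℚ.-_ (vanish f n b≤n)
  ; 0# = polynomial ℚ⟦q⟧.0# 0 λ _ _ → refl
  ; 1# = polynomial ℚ⟦q⟧.1# 1 λ where
      (suc _) _ → refl
  }

private
  module ℚ[q] = RawRing ℚ[q]

  ℚ-noZeroDivisors : ∀ {x y} → x ≢ 0ℚ → y ≢ 0ℚ → x ℚ.* y ≢ 0ℚ
  ℚ-noZeroDivisors = Heyting.x#0y#0→xy#0 ℚ.heytingCommutativeRing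

  all-zero : ∀ (f : Polynomial) → (∀ (i : Fin (bound f)) → coeff f (toℕ i) ≡ 0ℚ) → f ℚ[q].≈ ℚ[q].0#
  all-zero f all n with bound f ℕ.≤? n
  ... | yes b≤n = vanish f n b≤n
  ... | no b≰n = subst (λ m → coeff f m ≡ 0ℚ) (Fin.toℕ-fromℕ< (ℕ.≰⇒> b≰n)) (all (fromℕ< (ℕ.≰⇒> b≰n)))

  lowest : ∀ (f : Polynomial) → f ℚ[q].≉ ℚ[q].0# →
           ∃ λ i → coeff f i ≢ 0ℚ × (∀ {j} → j < i → coeff f j ≡ 0ℚ)
  lowest f f≉0
    with i , fᵢ≢0 , below ← Fin.¬∀⟶∃¬-smallest (bound f) _ (λ i → coeff f (toℕ i) ℚ.≟ 0ℚ) (f≉0 ∘ all-zero f)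
    = toℕ i , fᵢ≢0 , λ j<i → subst (λ m → coeff f m ≡ 0ℚ)
        (trans (Fin.toℕ-inject (fromℕ< j<i)) (Fin.toℕ-fromℕ< j<i)) (below (fromℕ< j<i))

  lowest-product : ∀ (f g : Polynomial) i j → (∀ {l} → l < i → coeff f l ≡ 0ℚ) → (∀ {l} → l < j → coeff g l ≡ 0ℚ) →
                   (coeff f ℚ⟦q⟧.* coeff g) (i + j) ≡ coeff f i ℚ.* coeff g j
  lowest-product f g i j f-below g-below = trans (sum-single v kᵢ others)
    (cong₂ (λ a b → coeff f a ℚ.* coeff g b) (Fin.toℕ-fromℕ< i<1+i+j)
      (trans (cong (i + j ∸_) (Fin.toℕ-fromℕ< i<1+i+j)) (ℕ.m+n∸m≡n i j)))
    where
    i<1+i+j : i < suc (i + j)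
    i<1+i+j = s≤s (ℕ.m≤m+n i j)
    kᵢ = fromℕ< i<1+i+j

    v : Vector.Vector ℚ (suc (i + j))
    v k = coeff f (toℕ k) ℚ.* coeff g (i + j ∸ toℕ k)

    others : ∀ k → k ≢ kᵢ → v k ≡ 0ℚ
    others k k≢ with ℕ.<-cmp (toℕ k) i
    ... | tri< k<i _ _ = trans (cong (ℚ._* coeff g _) (f-below k<i)) (ℚ.*-zeroˡ (coeff g _))
    ... | tri≈ _ k≡i _ = contradiction (Fin.toℕ-injective (trans k≡i (sym (Fin.toℕ-fromℕ< i<1+i+j)))) k≢
    ... | tri> _ _ i<k = trans (cong (coeff f (toℕ k) ℚ.*_) (g-below
            (subst (i + j ∸ toℕ k <_) (ℕ.m+n∸m≡n i j) (ℕ.∸-monoʳ-< i<k (s≤s⁻¹ (Fin.toℕ<n k))))))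
            (ℚ.*-zeroʳ (coeff f (toℕ k)))

ℚ[q]-1≉0 : ℚ[q].1# ℚ[q].≉ ℚ[q].0#
ℚ[q]-1≉0 1≈0 with () ← 1≈0 0

ℚ[q]-noZeroDivisors : ∀ f g → f ℚ[q].≉ ℚ[q].0# → g ℚ[q].≉ ℚ[q].0# → f ℚ[q].* g ℚ[q].≉ ℚ[q].0#
ℚ[q]-noZeroDivisors f g f≉0 g≉0 fg≈0
  with i , fᵢ≢0 , f-below ← lowest f f≉0 | j , gⱼ≢0 , g-below ← lowest g g≉0
  = ℚ-noZeroDivisors fᵢ≢0 gⱼ≢0
      (trans (sym (lowest-product f g i j f-below g-below)) (fg≈0 (i + j)))

open Fractions ℚ[q] ℚ[q]-1≉0 ℚ[q]-noZeroDivisors public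
  using (Fraction; fraction; module Fraction) renaming (fractionRawRing to ℚ⟨q⟩; fromBase to fromℚ[q])

q : RawRing.Carrier ℚ⟨q⟩
q = fromℚ[q] (polynomial ℚ⟦q⟧.X 2 λ where
  (suc (suc _)) _ → refl
  (suc zero) (s≤s ()))

generatingFunction : List ℕ → PowerSeries.Series ℚ⟨q⟩
generatingFunction τ n = foldr _+q_ 0# (map (λ π → q ^ μ τ π) (NC n))
  where
  open RawRing ℚ⟨q⟩ using (0#) renaming (_+_ to _+q_)
  open RawSemiringDefinitions (RawRing.rawSemiring ℚ⟨q⟩) using (_^_)

module Submission where

-- Split a non-crossing partition at the first two elements of its first block:
-- this is the binary tree behind F = 1 + x F².  Put E u = node leaf u.  An
-- occurrence of 1ᵃ (ρ + 1) 1ᵇ starts at the first letter of a tree exactly when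
-- the tree is Eᵃ⁻¹ (node ρ (Eᵇ⁻¹ u)) with u ≠ leaf.  Let F be the series of all
-- trees weighted by q^occ, Kⱼ the series of the trees u ≠ leaf weighted by
-- q^occ (Eʲ u), and K = K_(b-1).  Separating the occurrence at the first letter,
--   F + (1 - q) x^(m+a+b-1) K = 1 + x F²,
--   Kⱼ₊₁ + (1 - q) x^(m+a+b-2-j) K = Kⱼ  if j + 1 < a,   Kⱼ₊₁ = Kⱼ  otherwise.
-- As K₀ = F - 1, the second line telescopes to Q K = (1 - x) (F - 1), and then the
-- first line becomes P (F - 1) = x Q F², which is solved by completing the square.

open import Defs
import Algebra.Definitions.RawSemiring as RawSemiringDefinitions
import Algebra.Morphism.RingMonomorphism as RingMonomorphism
import Algebra.Properties.CommutativeMonoid.Sum as Sum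
import Algebra.Properties.Group
import Algebra.Properties.Ring
import Algebra.Properties.Semiring.Exp as Exp
import Algebra.Solver.Ring.NaturalCoefficients.Default as SemiringSolver
import Data.Fin.Properties as Fin
import Data.List.Relation.Unary.All.Properties as All
import Data.List.Relation.Unary.AllPairs.Properties as AllPairs
import Data.List.Relation.Unary.Unique.Propositional.Properties as Unique
import Relation.Binary.Reasoning.Setoid as SetoidReasoning
open import Algebra.Bundles using (CommutativeRing; RawRing)
open import Algebra.Structures using (IsCommutativeRing)
open import Data.Bool.Base using (Bool; true; false; _∧_; if_then_else_)
open import Data.Fin.Base as Fin using (Fin; toℕ; fromℕ<)
open import Data.List.Base using (List; []; _∷_; _++_; map; foldr; length; lookup; concat; tabulate; cartesianProductWith; zip; take; drop; filter; upTo; applyUpTo; replicate)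
open import Data.List.Properties using (∷-injective; ∷-injectiveˡ; ∷-injectiveʳ; ++-assoc; take++drop≡id; length-take; length-++; length-map; length-replicate; tabulate-cong)
open import Data.List.Membership.Propositional using (_∈_)
open import Data.List.Membership.Propositional.Properties using (∈-++⁺ˡ; ∈-++⁺ʳ; ∈-++⁻; ∈-concat⁺′; ∈-concat⁻′; ∈-tabulate⁺; ∈-tabulate⁻; ∈-cartesianProductWith⁺; ∈-cartesianProductWith⁻; ∈-map⁺; ∈-map⁻)
open import Data.List.Membership.Propositional.Properties.WithK using (unique∧set⇒bag)
open import Data.List.Relation.Binary.BagAndSetEquality using (∼bag⇒↭)
open import Data.List.Relation.Binary.Permutation.Propositional as Perm using (_↭_)
open import Data.List.Relation.Binary.Sublist.Heterogeneous.Properties using (∷ˡ⁻)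
open import Data.List.Relation.Binary.Sublist.Propositional using (_⊆_; []; _∷_; _∷ʳ_; to∈; from∈; ⊆-refl)
open import Data.List.Relation.Unary.All as All using (All; []; _∷_)
open import Data.List.Relation.Unary.AllPairs as AllPairs using (AllPairs; []; _∷_)
open import Data.List.Relation.Unary.Any using (here; there)
open import Data.List.Relation.Unary.Unique.Propositional using (Unique)
open import Data.Nat.Base using (ℕ; zero; suc; _+_; _∸_; _⊓_; _⊔_; _≤_; _<_; _>_; z≤n; s≤s; s≤s⁻¹; _≤′_; ≤′-refl; ≤′-step; >-nonZero)
open import Data.Nat.Properties as ℕ using ()
open import Data.Nat.Solver using (module +-*-Solver)
open import Data.Product.Base using (_×_; _,_; proj₁; proj₂; ∃; ∃₂; map₂)
open import Data.Rational.Properties as ℚ using ()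
open import Data.Sum.Base using (_⊎_; inj₁; inj₂)
open import Data.Unit.Base using (⊤; tt)
open import Function.Base using (_∘_; id; case_of_)
open import Function.Bundles using (mk⇔; Equivalence)
open import Level using (0ℓ) renaming (_⊔_ to _⊔ˡ_)
open import Relation.Binary.PropositionalEquality as ≡ using (_≡_; _≢_; refl; sym; trans; cong; cong₂; subst)
open import Relation.Nullary using (¬_; Dec; yes; no; does; contradiction)
open import Relation.Nullary.Decidable using (decidable-stable; dec-true; dec-false)

-- The obstacle is overlap: the closing run of ones of one occurrence can serve as the opening run
-- of the next. Removing an occurrence at the first letter therefore leaves not a free tree but a
-- tree `u` preceded by b - 1 ones, and these ones may complete further occurrences. The series Kⱼ
-- record this effect one added letter at a time. Since `ρ` is not empty, the number of ones in
-- front of the copy of `ρ` is determined by the tree, so an added one creates an occurrence on the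
-- trees of a single shape only, and none at all once a ones have been added. Hence the chain from
-- K₀ to K has min{a, b} - 1 nontrivial steps, which is where s and t come from. On the side of
-- words, an occurrence never leaves the gap in which it starts, because the letter after a gap is
-- smaller than every letter in it. This makes the number of occurrences additive over the tree.

-- Power series over a commutative ring.

module SeriesRing {c ℓ} (R : CommutativeRing c ℓ) where

  private
    module R = CommutativeRing R
  open PowerSeries R.rawRing
  open SemiringSolver R.commutativeSemiring using (solve; _:=_; _:+_; _:*_; con)
  open SetoidReasoning R.setoid

  tail : Series → Series
  tail f n = f (suc n)

  scale : R.Carrier → Series → Series
  scale r f n = r R.* f n

  -- Like most laws below, this is an induction on the index: `(f * g) (suc n)` reduces to
  -- `f 0 R.* g (suc n) R.+ (tail f * g) n`, and `(f * g) 0` to `f 0 R.* g 0 R.+ R.0#`.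
  *-cong : ∀ {f f′ g g′} → f ≈ f′ → g ≈ g′ → f * g ≈ f′ * g′
  *-cong f≈f′ g≈g′ zero = R.+-congʳ (R.*-cong (f≈f′ 0) (g≈g′ 0))
  *-cong f≈f′ g≈g′ (suc n) =
    R.+-cong (R.*-cong (f≈f′ 0) (g≈g′ (suc n))) (*-cong (f≈f′ ∘ suc) g≈g′ n)

  *-zeroˡ : ∀ g → 0# * g ≈ 0#
  *-zeroˡ g zero = R.trans (R.+-congʳ (R.zeroˡ _)) (R.+-identityˡ _)
  *-zeroˡ g (suc n) = R.trans (R.+-cong (R.zeroˡ _) (*-zeroˡ g n)) (R.+-identityˡ _)

  constant-* : ∀ r g → constant r * g ≈ scale r g
  constant-* r g zero = R.+-identityʳ _
  constant-* r g (suc n) = R.trans (R.+-congˡ (*-zeroˡ g n)) (R.+-identityʳ _)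

  -- The mirror image of the definitional recursion: the last summand of the convolution is split
  -- off instead of the first. Commutativity plays the two recursions against each other.
  *-suc : ∀ f g n → (f * g) (suc n) R.≈ f (suc n) R.* g 0 R.+ (f * tail g) n
  *-suc f g zero =
    solve 4 (λ a b c d → a :* b :+ (c :* d :+ con 0) := c :* d :+ (a :* b :+ con 0))
      R.refl (f 0) (g 1) (f 1) (g 0)
  *-suc f g (suc n) = begin
    f 0 R.* g (suc (suc n)) R.+ (tail f * g) (suc n)
      ≈⟨ R.+-congˡ (*-suc (tail f) g n) ⟩
    f 0 R.* g (suc (suc n)) R.+ (f (suc (suc n)) R.* g 0 R.+ (tail f * tail g) n)
      ≈⟨ solve 3 (λ a b c → a :+ (b :+ c) := b :+ (a :+ c)) R.refl _ _ _ ⟩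
    f (suc (suc n)) R.* g 0 R.+ (f * tail g) (suc n) ∎

  *-comm : ∀ f g → f * g ≈ g * f
  *-comm f g zero = R.+-congʳ (R.*-comm _ _)
  *-comm f g (suc n) = begin
    f 0 R.* g (suc n) R.+ (tail f * g) n   ≈⟨ R.+-cong (R.*-comm _ _) (*-comm (tail f) g n) ⟩
    g (suc n) R.* f 0 R.+ (g * tail f) n   ≈⟨ *-suc g f n ⟨
    (g * f) (suc n)                        ∎

  *-distribʳ-⊕ : ∀ h f g → (f ⊕ g) * h ≈ (f * h) ⊕ (g * h)
  *-distribʳ-⊕ h f g zero =
    solve 3 (λ f g h → (f :+ g) :* h :+ con 0 := (f :* h :+ con 0) :+ (g :* h :+ con 0))
      R.refl _ _ _
  *-distribʳ-⊕ h f g (suc n) = begin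
    (f 0 R.+ g 0) R.* h (suc n) R.+ ((tail f ⊕ tail g) * h) n
      ≈⟨ R.+-congˡ (*-distribʳ-⊕ h (tail f) (tail g) n) ⟩
    (f 0 R.+ g 0) R.* h (suc n) R.+ ((tail f * h) n R.+ (tail g * h) n)
      ≈⟨ solve 5 (λ f g h u v → (f :+ g) :* h :+ (u :+ v) := (f :* h :+ u) :+ (g :* h :+ v))
           R.refl _ _ _ _ _ ⟩
    ((f * h) ⊕ (g * h)) (suc n) ∎

  scale-* : ∀ r f g → scale r f * g ≈ scale r (f * g)
  scale-* r f g zero =
    solve 3 (λ r f g → r :* f :* g :+ con 0 := r :* (f :* g :+ con 0)) R.refl _ _ _
  scale-* r f g (suc n) = begin
    r R.* f 0 R.* g (suc n) R.+ (scale r (tail f) * g) n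
      ≈⟨ R.+-congˡ (scale-* r (tail f) g n) ⟩
    r R.* f 0 R.* g (suc n) R.+ r R.* (tail f * g) n
      ≈⟨ solve 4 (λ r f g u → r :* f :* g :+ r :* u := r :* (f :* g :+ u)) R.refl _ _ _ _ ⟩
    r R.* (f * g) (suc n) ∎

  *-assoc : ∀ f g h → (f * g) * h ≈ f * (g * h)
  *-assoc f g h zero =
    solve 3 (λ f g h → (f :* g :+ con 0) :* h :+ con 0 := f :* (g :* h :+ con 0) :+ con 0)
      R.refl _ _ _
  *-assoc f g h (suc n) = begin
    (f 0 R.* g 0 R.+ R.0#) R.* h (suc n) R.+ ((scale (f 0) (tail g) ⊕ tail f * g) * h) n
      ≈⟨ R.+-congˡ (*-distribʳ-⊕ h (scale (f 0) (tail g)) (tail f * g) n) ⟩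
    (f 0 R.* g 0 R.+ R.0#) R.* h (suc n) R.+
      ((scale (f 0) (tail g) * h) n R.+ ((tail f * g) * h) n)
      ≈⟨ R.+-congˡ (R.+-cong (scale-* (f 0) (tail g) h n) (*-assoc (tail f) g h n)) ⟩
    (f 0 R.* g 0 R.+ R.0#) R.* h (suc n) R.+
      (f 0 R.* (tail g * h) n R.+ (tail f * (g * h)) n)
      ≈⟨ solve 5 (λ f g h u v → (f :* g :+ con 0) :* h :+ (f :* u :+ v) :=
                                f :* (g :* h :+ u) :+ v) R.refl _ _ _ _ _ ⟩
    (f * (g * h)) (suc n) ∎

  *-identityˡ : ∀ f → 1# * f ≈ f
  *-identityˡ f n = R.trans (constant-* R.1# f n) (R.*-identityˡ _)

  X-* : ∀ f n → (X * f) (suc n) R.≈ f n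
  X-* f n = R.trans (R.+-congʳ (R.zeroˡ _)) (R.trans (R.+-identityˡ _)
    (R.trans (*-cong {g = f} tail-X (λ _ → R.refl) n) (*-identityˡ f n)))
    where
    tail-X : tail X ≈ 1#
    tail-X zero = R.refl
    tail-X (suc _) = R.refl

  commutativeRing : CommutativeRing c ℓ
  commutativeRing = record
    { Carrier = Series
    ; _≈_ = _≈_
    ; _+_ = _⊕_
    ; _*_ = _*_
    ; -_ = -_
    ; 0# = 0#
    ; 1# = 1#
    ; isCommutativeRing = record
      { isRing = record
        { +-isAbelianGroup = record
          { isGroup = record
            { isMonoid = record
              { isSemigroup = record
                { isMagma = record
                  { isEquivalence = record
                    { refl = λ _ → R.refl
                    ; sym = λ f≈g n → R.sym (f≈g n)
                    ; trans = λ f≈g g≈h n → R.trans (f≈g n) (g≈h n)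
                    }
                  ; ∙-cong = λ f≈f′ g≈g′ n → R.+-cong (f≈f′ n) (g≈g′ n)
                  }
                ; assoc = λ f g h n → R.+-assoc (f n) (g n) (h n)
                }
              ; identity = (λ f n → R.+-identityˡ (f n)) , (λ f n → R.+-identityʳ (f n))
              }
            ; inverse = (λ f n → R.-‿inverseˡ (f n)) , (λ f n → R.-‿inverseʳ (f n))
            ; ⁻¹-cong = λ f≈g n → R.-‿cong (f≈g n)
            }
          ; comm = λ f g n → R.+-comm (f n) (g n)
          }
        ; *-cong = *-cong
        ; *-assoc = *-assoc
        ; *-identity = *-identityˡ , λ f n → R.trans (*-comm f 1# n) (*-identityˡ f n)
        ; distrib =
            (λ f g h n → R.trans (*-comm f (g ⊕ h) n) (R.trans (*-distribʳ-⊕ f g h n)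
              (R.+-cong (*-comm g f n) (*-comm h f n)))) ,
            *-distribʳ-⊕
        }
      ; *-comm = *-comm
      }
    }

  -- The inverse g of a series f with constant term 1 satisfies
  -- g (n + 1) = - (tail f * g) n, whose right-hand side involves only g 0, …, g n.
  module Inverse (f : Series) (f₀≈1 : f 0 R.≈ R.1#) where

    -- Stage `n` is correct up to index `n` and meaningless above it. The stages make the
    -- course-of-values recursion structural, and causality of the product ensures that no
    -- meaningless value reaches `inverse`.
    prefix : ℕ → Series
    prefix _ zero = R.1#
    prefix zero (suc _) = R.1#
    prefix (suc n) (suc k) = R.- (tail f * prefix n) k

    inverse : Series
    inverse n = prefix n n

    *-causal : ∀ f {g h} n → (∀ k → k ≤ n → g k R.≈ h k) → (f * g) n R.≈ (f * h) n
    *-causal f zero g≈h = R.+-congʳ (R.*-congˡ (g≈h 0 z≤n))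
    *-causal f (suc n) g≈h = R.+-cong (R.*-congˡ (g≈h (suc n) ℕ.≤-refl))
      (*-causal (tail f) n λ k k≤n → g≈h k (ℕ.m≤n⇒m≤1+n k≤n))

    prefix-suc : ∀ n k → k ≤ n → prefix (suc n) k R.≈ prefix n k
    prefix-suc n zero _ = R.refl
    prefix-suc (suc n) (suc k) (s≤s k≤n) = R.-‿cong (*-causal (tail f) k λ j j≤k →
      prefix-suc n j (ℕ.≤-trans j≤k k≤n))

    prefix-stable : ∀ {n k} → k ≤′ n → inverse k R.≈ prefix n k
    prefix-stable ≤′-refl = R.refl
    prefix-stable (≤′-step {n} k≤n) =
      R.trans (prefix-stable k≤n) (R.sym (prefix-suc n _ (ℕ.≤′⇒≤ k≤n)))

    *-inverseʳ : f * inverse ≈ 1#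
    *-inverseʳ zero = R.trans (R.+-identityʳ _) (R.trans (R.*-identityʳ _) f₀≈1)
    *-inverseʳ (suc n) = begin
      f 0 R.* (R.- (tail f * prefix n) n) R.+ (tail f * inverse) n
        ≈⟨ R.+-cong (R.trans (R.*-congʳ f₀≈1) (R.*-identityˡ _))
             (*-causal (tail f) n λ k k≤n → prefix-stable (ℕ.≤⇒≤′ k≤n)) ⟩
      R.- (tail f * prefix n) n R.+ (tail f * prefix n) n
        ≈⟨ R.-‿inverseˡ _ ⟩
      R.0# ∎

-- The ring of fractions of a domain.

module FractionField {c ℓ} (D : CommutativeRing c ℓ)
  (1≉0 : RawRing._≉_ (CommutativeRing.rawRing D) (CommutativeRing.1# D) (CommutativeRing.0# D))
  (*-≉0 : ∀ x y → RawRing._≉_ (CommutativeRing.rawRing D) x (CommutativeRing.0# D) →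
          RawRing._≉_ (CommutativeRing.rawRing D) y (CommutativeRing.0# D) →
          RawRing._≉_ (CommutativeRing.rawRing D) (CommutativeRing._*_ D x y) (CommutativeRing.0# D))
  (*-cancelˡ : ∀ d x y → RawRing._≉_ (CommutativeRing.rawRing D) d (CommutativeRing.0# D) →
          CommutativeRing._≈_ D (CommutativeRing._*_ D d x) (CommutativeRing._*_ D d y) →
          CommutativeRing._≈_ D x y) where

  open CommutativeRing D hiding (refl; sym; trans) renaming (_+_ to _+ᴰ_)
  private
    module D = CommutativeRing D
    module F = Fractions rawRing 1≉0 *-≉0
    module K = RawRing F.fractionRawRing
  open F.Fraction
  open SemiringSolver commutativeSemiring using (solve; _:=_; _:+_; _:*_; con)
  open SetoidReasoning setoid
  open Algebra.Properties.Ring ring using (-‿distribˡ-*)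

  -- Here cancellation in `D` enters: the two cross-multiplied equations combine only after
  -- multiplication by the middle denominator `den y`.
  ≈ᶠ-trans : ∀ {x y z} → x K.≈ y → y K.≈ z → x K.≈ z
  ≈ᶠ-trans {x} {y} {z} x≈y y≈z = *-cancelˡ (den y) _ _ (den≉0 y) (begin
    den y * (num x * den z) ≈⟨ solve 3 (λ a b c → a :* (b :* c) := (b :* a) :* c) D.refl _ _ _ ⟩
    (num x * den y) * den z ≈⟨ *-congʳ x≈y ⟩
    (num y * den x) * den z ≈⟨ solve 3 (λ a b c → (a :* b) :* c := (a :* c) :* b) D.refl _ _ _ ⟩
    (num y * den z) * den x ≈⟨ *-congʳ y≈z ⟩
    (num z * den y) * den x ≈⟨ solve 3 (λ a b c → (a :* b) :* c := b :* (a :* c)) D.refl _ _ _ ⟩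
    den y * (num z * den x) ∎)

  +ᶠ-cong : ∀ {x x′ y y′} → x K.≈ x′ → y K.≈ y′ → x K.+ y K.≈ x′ K.+ y′
  +ᶠ-cong {x} {x′} {y} {y′} x≈x′ y≈y′ = begin
    (num x * den y +ᴰ num y * den x) * (den x′ * den y′)
      ≈⟨ solve 6 (λ a b c d e f → (a :* d :+ c :* b) :* (e :* f) :=
                                  (a :* e) :* (d :* f) :+ (c :* f) :* (b :* e)) D.refl
           (num x) (den x) (num y) (den y) (den x′) (den y′) ⟩
    (num x * den x′) * (den y * den y′) +ᴰ (num y * den y′) * (den x * den x′)
      ≈⟨ +-cong (*-congʳ x≈x′) (*-congʳ y≈y′) ⟩
    (num x′ * den x) * (den y * den y′) +ᴰ (num y′ * den y) * (den x * den x′)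
      ≈⟨ solve 6 (λ a b c d e f → (a :* b) :* (d :* f) :+ (c :* d) :* (b :* e) :=
                                  (a :* f :+ c :* e) :* (b :* d)) D.refl
           (num x′) (den x) (num y′) (den y) (den x′) (den y′) ⟩
    (num x′ * den y′ +ᴰ num y′ * den x′) * (den x * den y) ∎

  *ᶠ-cong : ∀ {x x′ y y′} → x K.≈ x′ → y K.≈ y′ → x K.* y K.≈ x′ K.* y′
  *ᶠ-cong {x} {x′} {y} {y′} x≈x′ y≈y′ = begin
    (num x * num y) * (den x′ * den y′)
      ≈⟨ solve 4 (λ a b c d → (a :* b) :* (c :* d) := (a :* c) :* (b :* d)) D.refl _ _ _ _ ⟩
    (num x * den x′) * (num y * den y′)
      ≈⟨ *-cong x≈x′ y≈y′ ⟩
    (num x′ * den x) * (num y′ * den y)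
      ≈⟨ solve 4 (λ a b c d → (a :* c) :* (b :* d) := (a :* b) :* (c :* d)) D.refl _ _ _ _ ⟩
    (num x′ * num y′) * (den x * den y) ∎

  -ᶠ-cong : ∀ {x y} → x K.≈ y → K.- x K.≈ K.- y
  -ᶠ-cong {x} {y} x≈y = begin
    - num x * den y   ≈⟨ -‿distribˡ-* _ _ ⟨
    - (num x * den y) ≈⟨ -‿cong x≈y ⟩
    - (num y * den x) ≈⟨ -‿distribˡ-* _ _ ⟩
    - num y * den x   ∎

  +ᶠ-inverseˡ : ∀ x → (K.- x) K.+ x K.≈ K.0#
  +ᶠ-inverseˡ x = begin
    (- num x * den x +ᴰ num x * den x) * 1# ≈⟨ *-identityʳ _ ⟩
    - num x * den x +ᴰ num x * den x        ≈⟨ distribʳ _ _ _ ⟨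
    (- num x +ᴰ num x) * den x              ≈⟨ *-congʳ (-‿inverseˡ _) ⟩
    0# * den x                             ≈⟨ zeroˡ _ ⟩
    0#                                     ≈⟨ zeroˡ _ ⟨
    0# * (den x * den x)                   ∎

  +ᶠ-comm : ∀ x y → x K.+ y K.≈ y K.+ x
  +ᶠ-comm x y = solve 4 (λ a b c d → (a :* d :+ c :* b) :* (d :* b) :=
                                     (c :* b :+ a :* d) :* (b :* d)) D.refl
    (num x) (den x) (num y) (den y)

  +ᶠ-identityˡ : ∀ x → K.0# K.+ x K.≈ x
  +ᶠ-identityˡ x = solve 2 (λ a b → (con 0 :* b :+ a :* con 1) :* b := a :* (con 1 :* b)) D.refl
    (num x) (den x)

  *ᶠ-comm : ∀ x y → x K.* y K.≈ y K.* x
  *ᶠ-comm x y = solve 4 (λ a b c d → (a :* c) :* (d :* b) := (c :* a) :* (b :* d)) D.refl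
    (num x) (den x) (num y) (den y)

  *ᶠ-identityˡ : ∀ x → K.1# K.* x K.≈ x
  *ᶠ-identityˡ x = solve 2 (λ a b → (con 1 :* a) :* b := a :* (con 1 :* b)) D.refl (num x) (den x)

  *ᶠ-distribʳ-+ᶠ : ∀ x y z → (y K.+ z) K.* x K.≈ (y K.* x) K.+ (z K.* x)
  *ᶠ-distribʳ-+ᶠ x y z = solve 6 (λ a b c d e f →
      ((c :* f :+ e :* d) :* a) :* ((d :* b) :* (f :* b)) :=
      ((c :* a) :* (f :* b) :+ (e :* a) :* (d :* b)) :* ((d :* f) :* b)) D.refl
    (num x) (den x) (num y) (den y) (num z) (den z)

  fractionRing : CommutativeRing (c ⊔ˡ ℓ) ℓ
  fractionRing = record
    { Carrier = K.Carrier
    ; _≈_ = K._≈_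
    ; _+_ = K._+_
    ; _*_ = K._*_
    ; -_ = K.-_
    ; 0# = K.0#
    ; 1# = K.1#
    ; isCommutativeRing = record
      { isRing = record
        { +-isAbelianGroup = record
          { isGroup = record
            { isMonoid = record
              { isSemigroup = record
                { isMagma = record
                  { isEquivalence = record
                    { refl = D.refl
                    ; sym = D.sym
                    ; trans = λ {x} {y} {z} → ≈ᶠ-trans {x} {y} {z}
                    }
                  ; ∙-cong = λ {x} {x′} {y} {y′} → +ᶠ-cong {x} {x′} {y} {y′}
                  }
                ; assoc = λ x y z → solve 6 (λ a b c d e f →
                      ((a :* d :+ c :* b) :* f :+ e :* (b :* d)) :* (b :* (d :* f)) :=
                      (a :* (d :* f) :+ (c :* f :+ e :* d) :* b) :* ((b :* d) :* f)) D.refl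
                    (num x) (den x) (num y) (den y) (num z) (den z)
                }
              ; identity = +ᶠ-identityˡ , λ x → ≈ᶠ-trans {x K.+ K.0#} {K.0# K.+ x} {x}
                  (+ᶠ-comm x K.0#) (+ᶠ-identityˡ x)
              }
            ; inverse = +ᶠ-inverseˡ , λ x → ≈ᶠ-trans {x K.+ (K.- x)} {(K.- x) K.+ x} {K.0#}
                (+ᶠ-comm x (K.- x)) (+ᶠ-inverseˡ x)
            ; ⁻¹-cong = λ {x} {y} → -ᶠ-cong {x} {y}
            }
          ; comm = +ᶠ-comm
          }
        ; *-cong = λ {x} {x′} {y} {y′} → *ᶠ-cong {x} {x′} {y} {y′}
        ; *-assoc = λ x y z → solve 6 (λ a b c d e f →
              ((a :* c) :* e) :* (b :* (d :* f)) := (a :* (c :* e)) :* ((b :* d) :* f)) D.refl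
            (num x) (den x) (num y) (den y) (num z) (den z)
        ; *-identity = *ᶠ-identityˡ , λ x → ≈ᶠ-trans {x K.* K.1#} {K.1# K.* x} {x}
            (*ᶠ-comm x K.1#) (*ᶠ-identityˡ x)
        ; distrib = (λ x y z → ≈ᶠ-trans {x K.* (y K.+ z)} {(y K.+ z) K.* x} {(x K.* y) K.+ (x K.* z)}
            (*ᶠ-comm x (y K.+ z)) (≈ᶠ-trans {(y K.+ z) K.* x} {(y K.* x) K.+ (z K.* x)} {(x K.* y) K.+ (x K.* z)}
              (*ᶠ-distribʳ-+ᶠ x y z) (+ᶠ-cong {y K.* x} {x K.* y} {z K.* x} {x K.* z} (*ᶠ-comm y x) (*ᶠ-comm z x))))
            , *ᶠ-distribʳ-+ᶠ
        }
      ; *-comm = *ᶠ-comm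
      }
    }

-- The rings ℚ[q] and ℚ(q).

module _ where

  private
    module ℚ⟦q⟧ = SeriesRing ℚ.+-*-commutativeRing
    module ℚ[q] = RawRing ℚ[q]
  open Polynomial using (coeff)

  ℚ[q]-commutativeRing : CommutativeRing 0ℓ 0ℓ
  ℚ[q]-commutativeRing = record
    { Carrier = ℚ[q].Carrier
    ; _≈_ = ℚ[q]._≈_
    ; _+_ = ℚ[q]._+_
    ; _*_ = ℚ[q]._*_
    ; -_ = ℚ[q].-_
    ; 0# = ℚ[q].0#
    ; 1# = ℚ[q].1#
    -- Polynomials are added, multiplied and compared through their coefficients, so `coeff` is an
    -- injective homomorphism by definition and pulls the laws back from series.
    ; isCommutativeRing = RingMonomorphism.isCommutativeRing {R₁ = ℚ[q]} {R₂ = CommutativeRing.rawRing ℚ⟦q⟧.commutativeRing} {⟦_⟧ = coeff} (record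
      { isRingHomomorphism = record
        { isSemiringHomomorphism = record
          { isNearSemiringHomomorphism = record
            { +-isMonoidHomomorphism = record
              { isMagmaHomomorphism = record
                { isRelHomomorphism = record { cong = λ f≈g → f≈g }
                ; homo = λ _ _ _ → ≡.refl
                }
              ; ε-homo = λ _ → ≡.refl
              }
            ; *-homo = λ _ _ _ → ≡.refl
            }
          ; 1#-homo = λ _ → ≡.refl
          }
        ; -‿homo = λ _ _ → ≡.refl
        }
      ; injective = λ f≈g → f≈g
      }) (CommutativeRing.isCommutativeRing ℚ⟦q⟧.commutativeRing)
    }

  private
    module D = CommutativeRing ℚ[q]-commutativeRing
  open Algebra.Properties.Ring D.ring using (x∙y⁻¹≈ε⇒x≈y; x[y-z]≈xy-xz)

  open SetoidReasoning D.setoid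

  -- The absence of zero divisors only refutes that `x - y` is nonzero. Equality in ℚ is decidable,
  -- so the double negation can be removed at each coefficient.
  ℚ[q]-cancelˡ : ∀ d x y → ¬ d D.≈ D.0# → d D.* x D.≈ d D.* y → x D.≈ y
  ℚ[q]-cancelˡ d x y d≉0 dx≈dy = x∙y⁻¹≈ε⇒x≈y x y λ n →
    decidable-stable (_ ℚ.≟ _) λ ≢0 →
      ℚ[q]-noZeroDivisors d (x D.- y) d≉0 (λ ≈0 → ≢0 (≈0 n))
        (begin
          d D.* (x D.- y)         ≈⟨ x[y-z]≈xy-xz d x y ⟩
          d D.* x D.- d D.* y     ≈⟨ D.+-congʳ {D.- (d D.* y)} {d D.* x} {d D.* y} dx≈dy ⟩
          d D.* y D.- d D.* y     ≈⟨ D.-‿inverseʳ (d D.* y) ⟩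
          D.0#                    ∎)

ℚ⟨q⟩-commutativeRing : CommutativeRing 0ℓ 0ℓ
ℚ⟨q⟩-commutativeRing = FractionField.fractionRing ℚ[q]-commutativeRing ℚ[q]-1≉0 ℚ[q]-noZeroDivisors ℚ[q]-cancelˡ


-- Binary trees, their enumeration, and occurrences read off the tree.

-- node l r encodes a non-crossing partition whose first block is continued by
-- r; the elements between the first two elements of that block (or after its
-- only element) are partitioned by l.
data Tree : Set where
  leaf : Tree
  node : Tree → Tree → Tree

size : Tree → ℕ
size leaf = 0
size (node l r) = suc (size l + size r)

-- The first argument is fuel that makes the recursion on the size structural; any fuel not below
-- the size gives the same list.
treesWithin : ℕ → ℕ → List Tree
treesWithin _ zero = leaf ∷ []
treesWithin zero (suc n) = []
treesWithin (suc d) (suc n) = concat (tabulate {n = suc n} λ i →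
  cartesianProductWith node (treesWithin d (toℕ i)) (treesWithin d (n ∸ toℕ i)))

trees : ℕ → List Tree
trees n = treesWithin n n

treesWithin-irrelevant : ∀ {d d′} n → n ≤ d → n ≤ d′ → treesWithin d n ≡ treesWithin d′ n
treesWithin-irrelevant zero _ _ = refl
treesWithin-irrelevant {suc d} {suc d′} (suc n) (s≤s n≤d) (s≤s n≤d′) =
  cong concat (tabulate-cong λ i → let i≤n = ℕ.≤-pred (Fin.toℕ<n i) in
    cong₂ (cartesianProductWith node)
      (treesWithin-irrelevant (toℕ i) (ℕ.≤-trans i≤n n≤d) (ℕ.≤-trans i≤n n≤d′))
      (treesWithin-irrelevant (n ∸ toℕ i)
        (ℕ.≤-trans (ℕ.m∸n≤m n (toℕ i)) n≤d) (ℕ.≤-trans (ℕ.m∸n≤m n (toℕ i)) n≤d′)))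

nodes : ∀ n → Fin (suc n) → List Tree
nodes n i = cartesianProductWith node (trees (toℕ i)) (trees (n ∸ toℕ i))

trees-suc : ∀ n → trees (suc n) ≡ concat (tabulate (nodes n))
trees-suc n = cong concat (tabulate-cong {n = suc n} λ i →
  cong₂ (cartesianProductWith node)
    (treesWithin-irrelevant {n} (toℕ i) (ℕ.≤-pred (Fin.toℕ<n i)) ℕ.≤-refl)
    (treesWithin-irrelevant {n} (n ∸ toℕ i) (ℕ.m∸n≤m n (toℕ i)) ℕ.≤-refl))

isNode : Tree → Bool
isNode leaf = false
isNode (node _ _) = true

same : Tree → Tree → Bool
same leaf leaf = true
same leaf (node _ _) = false
same (node _ _) leaf = false
same (node l r) (node l′ r′) = same l l′ ∧ same r r′

same⇒≡ : ∀ t t′ → same t t′ ≡ true → t ≡ t′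
same⇒≡ leaf leaf _ = refl
same⇒≡ (node l r) (node l′ r′) eq with same l l′ in eqˡ | same r r′ in eqʳ
... | true | true = cong₂ node (same⇒≡ l l′ eqˡ) (same⇒≡ r r′ eqʳ)

same-refl : ∀ t → same t t ≡ true
same-refl leaf = refl
same-refl (node l r) = cong₂ _∧_ (same-refl l) (same-refl r)

same-leafʳ : ∀ t → isNode t ≡ true → same t leaf ≡ false
same-leafʳ (node _ _) _ = refl

extend : ℕ → Tree → Tree
extend zero t = t
extend (suc k) t = node leaf (extend k t)

-- An occurrence of 1ᵃ (ρ + 1) 1ᵇ, with a = a′ + 1 and b = b′ + 1, starts at the
-- first letter of (the word of) t if and only if t is
-- extend a′ (node ρ (extend b′ u)) for some u ≠ leaf.
module Shape (a′ b′ : ℕ) (ρ : Tree) where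

  -- Recognises `extend k u` with `u ≠ leaf`, that is, a first block whose word begins with at least
  -- k + 1 equal letters.
  tailShape : ℕ → Tree → Bool
  tailShape zero t = isNode t
  tailShape (suc k) leaf = false
  tailShape (suc k) (node l r) = same leaf l ∧ tailShape k r

  -- The number of leading ones is left variable because putting ones in front of a tree of a lower
  -- shape is what produces new occurrences.
  shape : ℕ → Tree → Bool
  shape _ leaf = false
  shape zero (node l r) = same ρ l ∧ tailShape b′ r
  shape (suc k) (node l r) = same leaf l ∧ shape k r

  occ : Tree → ℕ
  occ leaf = 0
  occ (node l r) = (if shape a′ (node l r) then 1 else 0) + (occ l + occ r)

  shape⇒size : ∀ k t → shape k t ≡ true → size ρ < size t
  shape⇒size zero (node l r) eq with same ρ l in eqˡ
  ... | true rewrite same⇒≡ ρ l eqˡ = s≤s (ℕ.m≤m+n (size l) (size r))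
  shape⇒size (suc k) (node l r) eq with same leaf l
  ... | true = ℕ.≤-trans (shape⇒size k r eq) (ℕ.m≤n⇒m≤1+n (ℕ.m≤n+m (size r) (size l)))

  -- A tree with an occurrence at its first letter contains `ρ` as a proper subtree. In particular
  -- the copy of `ρ` inside an occurrence contributes no occurrence of its own.
  occ-small : ∀ t → size t ≤ size ρ → occ t ≡ 0
  occ-small leaf _ = refl
  occ-small (node l r) sz with shape a′ (node l r) in eq
  ... | true = contradiction sz (ℕ.<⇒≱ (shape⇒size a′ (node l r) eq))
  ... | false = cong₂ _+_
    (occ-small l (ℕ.≤-trans (ℕ.m≤n⇒m≤1+n (ℕ.m≤m+n (size l) (size r))) sz))
    (occ-small r (ℕ.≤-trans (ℕ.m≤n⇒m≤1+n (ℕ.m≤n+m (size r) (size l))) sz))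

  shape-extend : ∀ j k t → shape (j + k) (extend j t) ≡ shape k t
  shape-extend zero k t = refl
  shape-extend (suc j) k t = shape-extend j k t

  module _ (isNode-ρ : isNode ρ ≡ true) where

    same-ρ-leaf : same ρ leaf ≡ false
    same-ρ-leaf = same-leafʳ ρ isNode-ρ

    -- Along the right spine, shape `k` has `ρ` as left child at depth `k`, where every larger shape
    -- has `leaf`. This is where `ρ` must be nonempty.
    shape-disjoint : ∀ k d t → shape k t ≡ true → shape (suc (d + k)) t ≡ false
    shape-disjoint zero d (node leaf r) eq with () ← ≡.trans (≡.sym eq) (cong (_∧ tailShape b′ r) same-ρ-leaf)
    shape-disjoint zero d (node (node _ _) r) eq = refl
    shape-disjoint (suc k) d (node leaf r) eq rewrite ℕ.+-suc d k = shape-disjoint k d r eq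

    shape-extend-leaf : ∀ i d t → shape i (extend (i + suc d) t) ≡ false
    shape-extend-leaf zero d t = cong (_∧ tailShape b′ (extend d t)) same-ρ-leaf
    shape-extend-leaf (suc i) d t = shape-extend-leaf i d t

-- Generating functions of weighted trees.

module TreeSum {c ℓ} (R : CommutativeRing c ℓ) where

  private module R = CommutativeRing R
  open R using (_≈_)
  open PowerSeries R.rawRing using (Series; constant; X)
  private module S = CommutativeRing (SeriesRing.commutativeRing R)
  open SeriesRing R using (X-*)
  open Exp S.semiring using (_^_)
  open SemiringSolver R.commutativeSemiring using (solve; _:=_; _:+_)
  open SetoidReasoning R.setoid
  open Sum R.+-commutativeMonoid using (sum; sum-cong-≋)

  total : ∀ {a} {A : Set a} → (A → R.Carrier) → List A → R.Carrier
  total w ts = foldr R._+_ R.0# (map w ts)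

  module _ {a} {A : Set a} where

    total-cong : ∀ {w w′ : A → R.Carrier} → (∀ t → w t ≈ w′ t) → ∀ ts → total w ts ≈ total w′ ts
    total-cong w≈w′ [] = R.refl
    total-cong w≈w′ (t ∷ ts) = R.+-cong (w≈w′ t) (total-cong w≈w′ ts)

    total-+ : ∀ (w w′ : A → R.Carrier) ts → total (λ t → w t R.+ w′ t) ts ≈ total w ts R.+ total w′ ts
    total-+ w w′ [] = R.sym (R.+-identityˡ _)
    total-+ w w′ (t ∷ ts) = R.trans (R.+-congˡ (total-+ w w′ ts))
      (solve 4 (λ a b c d → (a :+ b) :+ (c :+ d) := (a :+ c) :+ (b :+ d)) R.refl _ _ _ _)

    total-* : ∀ r (w : A → R.Carrier) ts → total (λ t → r R.* w t) ts ≈ r R.* total w ts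
    total-* r w [] = R.sym (R.zeroʳ _)
    total-* r w (t ∷ ts) = R.trans (R.+-congˡ (total-* r w ts)) (R.sym (R.distribˡ _ _ _))

    total-++ : ∀ (w : A → R.Carrier) ts ts′ → total w (ts ++ ts′) ≈ total w ts R.+ total w ts′
    total-++ w [] ts′ = R.sym (R.+-identityˡ _)
    total-++ w (t ∷ ts) ts′ = R.trans (R.+-congˡ (total-++ w ts ts′)) (R.sym (R.+-assoc _ _ _))

    total-concat-tabulate : ∀ {n} (w : A → R.Carrier) (h : Fin n → List A) →
      total w (concat (tabulate h)) ≈ sum (λ i → total w (h i))
    total-concat-tabulate {zero} w h = R.refl
    total-concat-tabulate {suc n} w h = R.trans (total-++ w (h Fin.zero) _)
      (R.+-congˡ (total-concat-tabulate w (h ∘ Fin.suc)))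

  total-↭ : ∀ {A : Set} (w : A → R.Carrier) {xs ys} → xs ↭ ys → total w xs R.≈ total w ys
  total-↭ w Perm.refl = R.refl
  total-↭ w (Perm.prep x p) = R.+-congˡ (total-↭ w p)
  total-↭ w (Perm.swap x y p) = R.trans (R.+-congˡ (R.+-congˡ (total-↭ w p)))
    (R.trans (R.sym (R.+-assoc _ _ _)) (R.trans (R.+-congʳ (R.+-comm _ _)) (R.+-assoc _ _ _)))
  total-↭ w (Perm.trans p p′) = R.trans (total-↭ w p) (total-↭ w p′)

  total-map : ∀ {A B : Set} {w : B → R.Carrier} {w′ : A → R.Carrier} (f : A → B) →
    (∀ x → w (f x) R.≈ w′ x) → ∀ xs → total w (map f xs) R.≈ total w′ xs
  total-map f eq [] = R.refl
  total-map f eq (x ∷ xs) = R.+-cong (eq x) (total-map f eq xs)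

  module _ {w f g : Tree → R.Carrier} (w-node : ∀ l r → w (node l r) ≈ f l R.* g r) where

    total-map-node : ∀ l rs → total w (map (node l) rs) ≈ f l R.* total g rs
    total-map-node l [] = R.sym (R.zeroʳ _)
    total-map-node l (r ∷ rs) = R.trans (R.+-cong (w-node l r) (total-map-node l rs)) (R.sym (R.distribˡ _ _ _))

    total-cartesianProductWith : ∀ ls rs →
      total w (cartesianProductWith node ls rs) ≈ total f ls R.* total g rs
    total-cartesianProductWith [] rs = R.sym (R.zeroˡ _)
    total-cartesianProductWith (l ∷ ls) rs = begin
      total w (map (node l) rs ++ cartesianProductWith node ls rs) ≈⟨ total-++ w (map (node l) rs) _ ⟩
      total w (map (node l) rs) R.+ total w (cartesianProductWith node ls rs)
        ≈⟨ R.+-cong (total-map-node l rs) (total-cartesianProductWith ls rs) ⟩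
      f l R.* total g rs R.+ total f ls R.* total g rs ≈⟨ R.distribʳ _ _ _ ⟨
      total f (l ∷ ls) R.* total g rs ∎

  gf : (Tree → R.Carrier) → Series
  gf w n = total w (trees n)

  gf-cong : ∀ {w w′} → (∀ t → w t ≈ w′ t) → gf w S.≈ gf w′
  gf-cong w≈w′ n = total-cong w≈w′ (trees n)

  gf-+ : ∀ w w′ → gf (λ t → w t R.+ w′ t) S.≈ gf w S.+ gf w′
  gf-+ w w′ n = total-+ w w′ (trees n)

  gf-* : ∀ r w → gf (λ t → r R.* w t) S.≈ constant r S.* gf w
  gf-* r w n = R.trans (total-* r w (trees n)) (R.sym (SeriesRing.constant-* R r (gf w) n))

  -- The list `trees (suc n)` is grouped by the size of the left child, which is the convolution
  -- defining the product of series; `X` accounts for the root.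
  gf-product : ∀ {w f g} → (∀ l r → w (node l r) ≈ f l R.* g r) →
    gf w S.≈ constant (w leaf) S.+ X S.* (gf f S.* gf g)
  gf-product {w} {f} {g} w-node zero = R.+-congˡ
    (R.sym (R.trans (R.+-identityʳ _) (R.zeroˡ _)))
  gf-product {w} {f} {g} w-node (suc n) = begin
    total w (trees (suc n)) ≡⟨ cong (total w) (trees-suc n) ⟩
    total w (concat (tabulate (nodes n)))
      ≈⟨ total-concat-tabulate w (nodes n) ⟩
    sum (λ i → total w (nodes n i))
      ≈⟨ sum-cong-≋ {suc n} (λ i →
           total-cartesianProductWith {w} {f} {g} w-node (trees (toℕ i)) (trees (n ∸ toℕ i))) ⟩
    (gf f S.* gf g) n ≈⟨ X-* (gf f S.* gf g) n ⟨
    (X S.* (gf f S.* gf g)) (suc n) ≈⟨ R.+-identityˡ _ ⟨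
    R.0# R.+ (X S.* (gf f S.* gf g)) (suc n) ∎

  gf-product₀ : ∀ {w f g} → w leaf ≈ R.0# → (∀ l r → w (node l r) ≈ f l R.* g r) →
    gf w S.≈ X S.* (gf f S.* gf g)
  gf-product₀ {w} {f} {g} w-leaf w-node n = R.trans (gf-product w-node n)
    (R.trans (R.+-congʳ (constant≈0 n)) (R.+-identityˡ _))
    where
    constant≈0 : constant (w leaf) S.≈ S.0#
    constant≈0 zero = w-leaf
    constant≈0 (suc _) = R.refl

  ι : Bool → R.Carrier
  ι b = if b then R.1# else R.0#

  ι-∧ : ∀ b b′ → ι (b ∧ b′) ≈ ι b R.* ι b′
  ι-∧ true b′ = R.sym (R.*-identityˡ _)
  ι-∧ false b′ = R.sym (R.zeroˡ _)

  gf-same : ∀ t → gf (ι ∘ same t) S.≈ X ^ size t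
  gf-same leaf = S.trans {gf (ι ∘ same leaf)}
    -- No node equals `leaf`, so the zero weight serves for both factors and the product term
    -- vanishes.
    (gf-product {f = λ _ → R.0#} {g = λ _ → R.0#} λ _ _ → R.sym (R.zeroˡ _))
    λ n → R.trans (R.+-congˡ (S.trans {X S.* (gf z S.* gf z)}
       (S.*-congˡ {X} (S.*-congʳ {gf z} {gf z} gf-0)) (S.trans {X S.* (S.0# S.* gf z)}
         (S.*-congˡ {X} (S.zeroˡ (gf z))) (S.zeroʳ X)) n)) (R.+-identityʳ _)
    where
    z : Tree → R.Carrier
    z _ = R.0#
    total-0 : ∀ ts → total z ts ≈ R.0#
    total-0 [] = R.refl
    total-0 (_ ∷ ts) = R.trans (R.+-identityˡ _) (total-0 ts)
    gf-0 : gf z S.≈ S.0#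
    gf-0 n = total-0 (trees n)
  gf-same (node l r) = S.trans {gf (ι ∘ same (node l r))}
    (gf-product₀ {f = ι ∘ same l} {g = ι ∘ same r} R.refl λ l′ r′ → ι-∧ (same l l′) (same r r′))
    (S.*-congˡ {X} (S.trans {gf (ι ∘ same l) S.* gf (ι ∘ same r)} {X ^ size l S.* X ^ size r}
      (S.*-cong {gf (ι ∘ same l)} (gf-same l) (gf-same r))
      (S.sym {X ^ (size l + size r)} (Exp.^-homo-* S.semiring X (size l) (size r)))))

-- The functional equations for the weighted trees.

module Weights {c ℓ} (R : CommutativeRing c ℓ) (q r : CommutativeRing.Carrier R)
  (r+q≈1 : CommutativeRing._≈_ R (CommutativeRing._+_ R r q) (CommutativeRing.1# R))
  (a′ b′ : ℕ) (ρ : Tree) (isNode-ρ : isNode ρ ≡ true) where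

  open CommutativeRing R using (_≈_) renaming (Carrier to C)
  private
    module R = CommutativeRing R
    module S = CommutativeRing (SeriesRing.commutativeRing R)
  open PowerSeries R.rawRing using (Series; constant; X)
  open TreeSum R
  open Shape a′ b′ ρ
  open SemiringSolver R.commutativeSemiring using (solve; _:=_; _:+_; _:*_; con)
  open Exp R.semiring using (_^_; ^-homo-*)
  module SExp = Exp S.semiring
  open SetoidReasoning R.setoid
  module SR = SetoidReasoning S.setoid

  m : ℕ
  m = size ρ

  weight : Tree → C
  weight t = q ^ occ t

  -- The weight without the factor coming from the first letter.
  weight₀ : Tree → C
  weight₀ leaf = R.0#
  weight₀ (node l r) = weight l R.* weight r

  weight-unshaped : ∀ t → isNode t ≡ true → shape a′ t ≡ false → weight t ≈ weight₀ t
  weight-unshaped (node l r) _ eq rewrite eq = ^-homo-* q (occ l) (occ r)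

  -- With r = 1 - q, the correction turns the factor q of an occurrence at the first letter into 1.
  -- Keeping it on the left avoids subtraction, which the semiring solver cannot treat.
  weight-shaped : ∀ t → isNode t ≡ true → weight t R.+ r R.* (ι (shape a′ t) R.* weight₀ t) ≈ weight₀ t
  weight-shaped (node l r′) _ with shape a′ (node l r′)
  ... | false = begin
    q ^ (occ l + occ r′) R.+ r R.* (R.0# R.* (weight l R.* weight r′))
      ≈⟨ R.+-congʳ (^-homo-* q (occ l) (occ r′)) ⟩
    weight l R.* weight r′ R.+ r R.* (R.0# R.* (weight l R.* weight r′))
      ≈⟨ solve 2 (λ u r → u :+ r :* (con 0 :* u) := u) R.refl _ r ⟩
    weight l R.* weight r′ ∎
  ... | true = begin
    q R.* q ^ (occ l + occ r′) R.+ r R.* (R.1# R.* (weight l R.* weight r′))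
      ≈⟨ R.+-congʳ (R.*-congˡ (^-homo-* q (occ l) (occ r′))) ⟩
    q R.* (weight l R.* weight r′) R.+ r R.* (R.1# R.* (weight l R.* weight r′))
      ≈⟨ solve 3 (λ u r q → q :* u :+ r :* (con 1 :* u) := (r :+ q) :* u) R.refl _ r q ⟩
    (r R.+ q) R.* (weight l R.* weight r′)
      ≈⟨ R.trans (R.*-congʳ r+q≈1) (R.*-identityˡ _) ⟩
    weight l R.* weight r′ ∎

  weight-ρ : weight ρ ≈ R.1#
  weight-ρ = R.reflexive (cong (q ^_) (occ-small ρ ℕ.≤-refl))

  shape⇒isNode : ∀ k t → shape k t ≡ true → isNode t ≡ true
  shape⇒isNode k (node _ _) _ = refl

  extended : ℕ → Tree → C
  extended k t = ι (isNode t) R.* weight (extend k t)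

  𝕂 : ℕ → Series
  𝕂 k = gf (extended k)

  -- The weight `φ` is arbitrary because each step of the induction removes one `node leaf` from the
  -- tree and hands it over to `φ`.
  gf-tailShape : ∀ k (φ : Tree → C) →
    gf (λ t → ι (tailShape k t) R.* φ t) S.≈ X SExp.^ k S.* gf (λ t → ι (isNode t) R.* φ (extend k t))
  gf-tailShape zero φ = S.sym (S.*-identityˡ (gf (λ t → ι (isNode t) R.* φ t)))
  gf-tailShape (suc k) φ = SR.begin
    gf (λ t → ι (tailShape (suc k) t) R.* φ t)
      SR.≈⟨ gf-product₀ {f = ι ∘ same leaf} {g = λ t → ι (tailShape k t) R.* φ (node leaf t)}
              (R.zeroˡ _) pointwise ⟩
    X S.* (gf (ι ∘ same leaf) S.* gf (λ t → ι (tailShape k t) R.* φ (node leaf t)))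
      SR.≈⟨ S.*-congˡ {X} (S.*-cong {gf (ι ∘ same leaf)} {S.1#} (gf-same leaf) (gf-tailShape k (φ ∘ node leaf))) ⟩
    X S.* (S.1# S.* (X SExp.^ k S.* gf (λ t → ι (isNode t) R.* φ (extend (suc k) t))))
      SR.≈⟨ S.*-congˡ {X} (S.*-identityˡ (X SExp.^ k S.* gf (λ t → ι (isNode t) R.* φ (extend (suc k) t)))) ⟩
    X S.* (X SExp.^ k S.* gf (λ t → ι (isNode t) R.* φ (extend (suc k) t)))
      SR.≈⟨ S.*-assoc X (X SExp.^ k) (gf (λ t → ι (isNode t) R.* φ (extend (suc k) t))) ⟨
    X SExp.^ suc k S.* gf (λ t → ι (isNode t) R.* φ (extend (suc k) t)) SR.∎
    where
    pointwise : ∀ l r → ι (same leaf l ∧ tailShape k r) R.* φ (node l r) ≈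
      ι (same leaf l) R.* (ι (tailShape k r) R.* φ (node leaf r))
    pointwise leaf r = R.sym (R.*-identityˡ _)
    pointwise (node _ _) r = R.trans (R.zeroˡ _) (R.sym (R.zeroˡ _))

  -- Deleting the k leading ones, the letter before `ρ`, `ρ` itself and the b′ ones after it leaves
  -- the tree `u` counted by `𝕂 b′`. The bound on `k` ensures that no letter between the first one
  -- and `ρ` starts an occurrence: the trees beginning there have a shape below `a′`.
  gf-shape : ∀ k → k ≤ a′ →
    gf (λ t → ι (shape k t) R.* weight₀ t) S.≈ X SExp.^ (k + suc (m + b′)) S.* 𝕂 b′
  gf-shape zero _ = SR.begin
    gf (λ t → ι (shape 0 t) R.* weight₀ t)
      SR.≈⟨ gf-product₀ {f = ι ∘ same ρ} {g = λ t → ι (tailShape b′ t) R.* weight t}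
              (R.zeroˡ _) pointwise ⟩
    X S.* (gf (ι ∘ same ρ) S.* gf (λ t → ι (tailShape b′ t) R.* weight t))
      SR.≈⟨ S.*-congˡ {X} (S.*-cong {gf (ι ∘ same ρ)} {X SExp.^ m} (gf-same ρ) (gf-tailShape b′ weight)) ⟩
    X S.* (X SExp.^ m S.* (X SExp.^ b′ S.* 𝕂 b′))
      SR.≈⟨ S.*-congˡ {X} (S.*-assoc (X SExp.^ m) (X SExp.^ b′) (𝕂 b′)) ⟨
    X S.* (X SExp.^ m S.* X SExp.^ b′ S.* 𝕂 b′)
      SR.≈⟨ S.*-congˡ {X} (S.*-congʳ {𝕂 b′} {X SExp.^ (m + b′)} (SExp.^-homo-* X m b′)) ⟨
    X S.* (X SExp.^ (m + b′) S.* 𝕂 b′)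
      SR.≈⟨ S.*-assoc X (X SExp.^ (m + b′)) (𝕂 b′) ⟨
    X SExp.^ suc (m + b′) S.* 𝕂 b′ SR.∎
    where
    pointwise : ∀ l r → ι (same ρ l ∧ tailShape b′ r) R.* (weight l R.* weight r) ≈
      ι (same ρ l) R.* (ι (tailShape b′ r) R.* weight r)
    pointwise l r with same ρ l in eq
    ... | false = R.trans (R.zeroˡ _) (R.sym (R.zeroˡ _))
    ... | true = begin
      ι (tailShape b′ r) R.* (weight l R.* weight r)
        ≈⟨ R.*-congˡ (R.*-congʳ (subst (λ t → weight t ≈ R.1#) (same⇒≡ ρ l eq) weight-ρ)) ⟩
      ι (tailShape b′ r) R.* (R.1# R.* weight r)
        ≈⟨ solve 2 (λ u v → u :* (con 1 :* v) := con 1 :* (u :* v)) R.refl _ _ ⟩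
      R.1# R.* (ι (tailShape b′ r) R.* weight r) ∎
  gf-shape (suc k) k<a = SR.begin
    gf (λ t → ι (shape (suc k) t) R.* weight₀ t)
      SR.≈⟨ gf-product₀ {f = ι ∘ same leaf} {g = λ t → ι (shape k t) R.* weight₀ t}
              (R.zeroˡ _) pointwise ⟩
    X S.* (gf (ι ∘ same leaf) S.* gf (λ t → ι (shape k t) R.* weight₀ t))
      SR.≈⟨ S.*-congˡ {X} (S.*-cong {gf (ι ∘ same leaf)} {S.1#} (gf-same leaf) (gf-shape k (ℕ.<⇒≤ k<a))) ⟩
    X S.* (S.1# S.* (X SExp.^ (k + suc (m + b′)) S.* 𝕂 b′))
      SR.≈⟨ S.*-congˡ {X} (S.*-identityˡ (X SExp.^ (k + suc (m + b′)) S.* 𝕂 b′)) ⟩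
    X S.* (X SExp.^ (k + suc (m + b′)) S.* 𝕂 b′)
      SR.≈⟨ S.*-assoc X (X SExp.^ (k + suc (m + b′))) (𝕂 b′) ⟨
    X SExp.^ (suc k + suc (m + b′)) S.* 𝕂 b′ SR.∎
    where
    shaped : ∀ t → ι (shape k t) R.* weight t ≈ ι (shape k t) R.* weight₀ t
    shaped t with shape k t in eq
    ... | false = R.trans (R.zeroˡ _) (R.sym (R.zeroˡ _))
    ... | true = R.*-congˡ (weight-unshaped t (shape⇒isNode k t eq)
      (subst (λ i → shape i t ≡ false)
        (≡.trans (≡.sym (ℕ.+-suc (a′ ∸ suc k) k)) (ℕ.m∸n+n≡m k<a))
        (shape-disjoint isNode-ρ k (a′ ∸ suc k) t eq)))
    pointwise : ∀ l r → ι (same leaf l ∧ shape k r) R.* (weight l R.* weight r) ≈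
      ι (same leaf l) R.* (ι (shape k r) R.* weight₀ r)
    pointwise (node _ _) r = R.trans (R.zeroˡ _) (R.sym (R.zeroˡ _))
    pointwise leaf r = begin
      ι (shape k r) R.* (R.1# R.* weight r) ≈⟨ R.*-congˡ (R.*-identityˡ _) ⟩
      ι (shape k r) R.* weight r            ≈⟨ shaped r ⟩
      ι (shape k r) R.* weight₀ r           ≈⟨ R.*-identityˡ _ ⟨
      R.1# R.* (ι (shape k r) R.* weight₀ r) ∎

  -- For i ≤ j the tree `extend i t` has shape i + k, which is below `a′`, so neither the added ones
  -- nor the first letter of `t` start an occurrence. The slack `d` grows as `j` shrinks.
  weight-extend : ∀ k t → shape k t ≡ true → ∀ j d → a′ ≡ j + suc (d + k) →
    weight (extend j t) ≈ weight₀ t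
  weight-extend k t eq zero d a′≡ = weight-unshaped t (shape⇒isNode k t eq)
    (≡.trans (cong (λ i → shape i t) a′≡) (shape-disjoint isNode-ρ k d t eq))
  weight-extend k t eq (suc j) d a′≡ = begin
    weight (extend (suc j) t)
      ≈⟨ weight-unshaped (extend (suc j) t) refl (≡.trans (cong (λ i → shape i (extend (suc j) t)) a′≡)
           (≡.trans (shape-extend (suc j) (suc (d + k)) t) (shape-disjoint isNode-ρ k d t eq))) ⟩
    R.1# R.* weight (extend j t) ≈⟨ R.*-identityˡ _ ⟩
    weight (extend j t)
      ≈⟨ weight-extend k t eq j (suc d) (≡.trans a′≡ (≡.sym (ℕ.+-suc j (suc (d + k))))) ⟩
    weight₀ t ∎

  -- The new first letter of `extend (suc j) t` starts an occurrence exactly when `t` has shape k =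
  -- a′ - 1 - j. The second summand restores the weight lost on these trees.
  𝕂-suc : ∀ j k → a′ ≡ suc (j + k) →
    𝕂 (suc j) S.+ constant r S.* (X SExp.^ (k + suc (m + b′)) S.* 𝕂 b′) S.≈ 𝕂 j
  𝕂-suc j k a′≡ = SR.begin
    𝕂 (suc j) S.+ constant r S.* (X SExp.^ (k + suc (m + b′)) S.* 𝕂 b′)
      SR.≈⟨ S.+-congˡ {𝕂 (suc j)} (S.*-congˡ {constant r} (gf-shape k (subst (k ≤_) (≡.sym a′≡) (ℕ.m≤n⇒m≤1+n (ℕ.m≤n+m k j))))) ⟨
    𝕂 (suc j) S.+ constant r S.* gf (λ t → ι (shape k t) R.* weight₀ t)
      SR.≈⟨ S.+-congˡ {𝕂 (suc j)} (gf-* r (λ t → ι (shape k t) R.* weight₀ t)) ⟨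
    𝕂 (suc j) S.+ gf (λ t → r R.* (ι (shape k t) R.* weight₀ t))
      SR.≈⟨ gf-+ (extended (suc j)) (λ t → r R.* (ι (shape k t) R.* weight₀ t)) ⟨
    gf (λ t → extended (suc j) t R.+ r R.* (ι (shape k t) R.* weight₀ t))
      SR.≈⟨ gf-cong pointwise ⟩
    𝕂 j SR.∎
    where
    pointwise : ∀ t → extended (suc j) t R.+ r R.* (ι (shape k t) R.* weight₀ t) ≈ extended j t
    pointwise leaf = solve 3 (λ u v r → con 0 :* u :+ r :* (con 0 :* con 0) := con 0 :* v) R.refl _ _ _
    pointwise t@(node _ _) with shape k t in eq
    ... | true = begin
      R.1# R.* weight (extend (suc j) t) R.+ r R.* (R.1# R.* weight₀ t)
        ≈⟨ R.+-cong (R.*-identityˡ _) (R.*-congˡ (R.*-cong (R.reflexive (cong ι (≡.sym shaped)))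
             (R.sym (R.trans (R.*-identityˡ _) (weight-extend k t eq j 0
               (≡.trans a′≡ (≡.sym (ℕ.+-suc j k)))))))) ⟩
      weight (extend (suc j) t) R.+ r R.* (ι (shape a′ (extend (suc j) t)) R.* weight₀ (extend (suc j) t))
        ≈⟨ weight-shaped (extend (suc j) t) refl ⟩
      -- This is `extended j t` by computation, as `weight leaf` and `ι true` both reduce to `R.1#`.
      weight₀ (extend (suc j) t) ∎
      where
      shaped : shape a′ (extend (suc j) t) ≡ true
      shaped = ≡.trans (cong (λ i → shape i (extend (suc j) t)) a′≡) (≡.trans (shape-extend j k t) eq)
    ... | false = begin
      R.1# R.* weight (extend (suc j) t) R.+ r R.* (R.0# R.* weight₀ t)
        ≈⟨ solve 3 (λ u v r → con 1 :* u :+ r :* (con 0 :* v) := u) R.refl _ _ _ ⟩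
      weight (extend (suc j) t)
        ≈⟨ weight-unshaped (extend (suc j) t) refl
             (≡.trans (cong (λ i → shape i (extend (suc j) t)) a′≡) (≡.trans (shape-extend j k t) eq)) ⟩
      weight₀ (extend (suc j) t) ∎

  -- With more than `a′` ones in front, the left child at depth `a′` is `leaf` where an occurrence
  -- needs `ρ`, so the new letter starts none.
  𝕂-stable : ∀ d → 𝕂 (suc (a′ + d)) S.≈ 𝕂 (a′ + d)
  𝕂-stable d = gf-cong λ t → R.*-congˡ (R.trans
    (weight-unshaped (extend (suc (a′ + d)) t) refl
      (subst (λ j → shape a′ (extend j t) ≡ false) (ℕ.+-suc a′ d) (shape-extend-leaf isNode-ρ a′ d t)))
    (R.*-identityˡ _))

  𝕂-constant : ∀ d → 𝕂 (a′ + d) S.≈ 𝕂 a′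
  𝕂-constant zero n = R.reflexive (cong (λ j → 𝕂 j n) (ℕ.+-identityʳ a′))
  𝕂-constant (suc d) n = R.trans (R.reflexive (cong (λ j → 𝕂 j n) (ℕ.+-suc a′ d)))
    (R.trans (𝕂-stable d n) (𝕂-constant d n))

  gf-weight : gf weight S.≈ S.1# S.+ 𝕂 0
  gf-weight = SR.begin
    gf weight SR.≈⟨ gf-cong pointwise ⟩
    gf (λ t → ι (same leaf t) R.+ extended 0 t) SR.≈⟨ gf-+ (ι ∘ same leaf) (extended 0) ⟩
    gf (ι ∘ same leaf) S.+ 𝕂 0 SR.≈⟨ S.+-congʳ {𝕂 0} {gf (ι ∘ same leaf)} {S.1#} (gf-same leaf) ⟩
    S.1# S.+ 𝕂 0 SR.∎
    where
    pointwise : ∀ t → weight t ≈ ι (same leaf t) R.+ extended 0 t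
    pointwise leaf = R.sym (R.trans (R.+-congˡ (R.zeroˡ _)) (R.+-identityʳ _))
    pointwise (node _ _) = R.sym (R.trans (R.+-identityˡ _) (R.*-identityˡ _))

  gf-weight-product : gf weight S.+ constant r S.* (X SExp.^ (a′ + suc (m + b′)) S.* 𝕂 b′) S.≈
    S.1# S.+ X S.* (gf weight S.* gf weight)
  gf-weight-product = SR.begin
    gf weight S.+ constant r S.* (X SExp.^ (a′ + suc (m + b′)) S.* 𝕂 b′)
      SR.≈⟨ S.+-congˡ {gf weight} (S.*-congˡ {constant r} (gf-shape a′ ℕ.≤-refl)) ⟨
    gf weight S.+ constant r S.* gf (λ t → ι (shape a′ t) R.* weight₀ t)
      SR.≈⟨ S.+-congˡ {gf weight} (gf-* r (λ t → ι (shape a′ t) R.* weight₀ t)) ⟨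
    gf weight S.+ gf (λ t → r R.* (ι (shape a′ t) R.* weight₀ t))
      SR.≈⟨ gf-+ weight (λ t → r R.* (ι (shape a′ t) R.* weight₀ t)) ⟨
    gf (λ t → weight t R.+ r R.* (ι (shape a′ t) R.* weight₀ t))
      SR.≈⟨ gf-product {f = weight} {g = weight} (λ l r → weight-shaped (node l r) refl) ⟩
    constant (R.1# R.+ r R.* (R.0# R.* R.0#)) S.+ X S.* (gf weight S.* gf weight)
      SR.≈⟨ S.+-congʳ {X S.* (gf weight S.* gf weight)} {constant (R.1# R.+ r R.* (R.0# R.* R.0#))} {S.1#} constant≈1 ⟩
    S.1# S.+ X S.* (gf weight S.* gf weight) SR.∎
    where
    constant≈1 : constant (R.1# R.+ r R.* (R.0# R.* R.0#)) S.≈ S.1#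
    constant≈1 zero = solve 1 (λ r → con 1 :+ r :* (con 0 :* con 0) := con 1) R.refl r
    constant≈1 (suc _) = R.refl

-- Elimination of K and solution of the quadratic equation.

module Elimination {c ℓ} (S : CommutativeRing c ℓ) where
  open CommutativeRing S hiding (refl; sym; trans) renaming (_+_ to _⊕_)
  private module S = CommutativeRing S
  open SemiringSolver commutativeSemiring using (solve; _:=_; _:+_; _:*_; con)
  open Algebra.Properties.Group +-group using (∙-cancelʳ)
  open RawSemiringDefinitions (RawRing.rawSemiring rawRing) using () renaming (_×_ to _·_)
  open SetoidReasoning setoid

  minus-plus : ∀ x y → (x - y) ⊕ y ≈ x
  minus-plus x y = S.trans (+-assoc _ _ _) (S.trans (+-congˡ (-‿inverseˡ y)) (+-identityʳ x))

  -- Summing the relations between consecutive Kⱼ gives a geometric sum of powers of x. Multiplied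
  -- by y = 1 - x it collapses to its end terms, so the left-hand side becomes an invariant whose
  -- power of x drops by one per step.
  geometric-step : ∀ x y r p k k₁ k₀ e → y ⊕ x ≈ 1# →
    k₁ ⊕ r * (p * k) ≈ k₀ → y * k₀ ⊕ r * ((x * p) * k) ≈ e →
    y * k₁ ⊕ r * (p * k) ≈ e
  geometric-step x y r p k k₁ k₀ e y+x≈1 step hyp = begin
    y * k₁ ⊕ r * (p * k)
      ≈⟨ +-congˡ (*-identityˡ _) ⟨
    y * k₁ ⊕ 1# * (r * (p * k))
      ≈⟨ +-congˡ (*-congʳ y+x≈1) ⟨
    y * k₁ ⊕ (y ⊕ x) * (r * (p * k))
      ≈⟨ solve 6 (λ x y r p k k₁ → y :* k₁ :+ (y :+ x) :* (r :* (p :* k)) :=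
           y :* (k₁ :+ r :* (p :* k)) :+ r :* ((x :* p) :* k)) S.refl x y r p k k₁ ⟩
    y * (k₁ ⊕ r * (p * k)) ⊕ r * ((x * p) * k)
      ≈⟨ +-congʳ (*-congˡ step) ⟩
    y * k₀ ⊕ r * ((x * p) * k)
      ≈⟨ hyp ⟩
    e ∎

  -- The letters stand for r = 1 - q, p = x^(m+t), u = x^(s-1), k = K, g = F - 1, f = F, and i is
  -- the inverse of `P`.
  module Quadratic (x r p u k g f i : Carrier) where
    private
      y = 1# - x
      P = y ⊕ r * (1# - x * u) * p
      Q = y ⊕ r * (1# - u) * p

    module Solution (f≈1+g : f ≈ 1# ⊕ g)
             (k-eq : y * k ⊕ r * (p * k) ≈ y * g ⊕ r * ((p * u) * k))
             (f-eq : f ⊕ r * ((p * u) * k) ≈ 1# ⊕ x * (f * f))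
             (Pi≈1 : P * i ≈ 1#) where

      Qk≈yg : Q * k ≈ y * g
      -- Here and below, differences such as `1# - u` are opaque to the semiring solver; they are
      -- eliminated by adding the same term to both sides and using `minus-plus`.
      Qk≈yg = ∙-cancelʳ (r * ((p * u) * k)) (Q * k) (y * g) (begin
        Q * k ⊕ r * ((p * u) * k)
          ≈⟨ solve 6 (λ y v u r p k → (y :+ r :* v :* p) :* k :+ r :* ((p :* u) :* k) :=
                                     y :* k :+ (v :+ u) :* (r :* (p :* k))) S.refl y (1# - u) u r p k ⟩
        y * k ⊕ ((1# - u) ⊕ u) * (r * (p * k))
          ≈⟨ +-congˡ (S.trans (*-congʳ (minus-plus 1# u)) (*-identityˡ _)) ⟩
        y * k ⊕ r * (p * k) ≈⟨ k-eq ⟩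
        y * g ⊕ r * ((p * u) * k) ∎)

      -- The difference of `P` and `Q` is r p (u - x u), and u - x u = y u.
      P≈ : P ≈ Q ⊕ r * (p * u) * y
      P≈ = ∙-cancelʳ (r * (x * u) * p) _ _ (begin
        P ⊕ r * (x * u) * p
          ≈⟨ solve 5 (λ y v w r p → y :+ r :* v :* p :+ r :* w :* p := y :+ (v :+ w) :* (r :* p))
               S.refl y (1# - x * u) (x * u) r p ⟩
        y ⊕ ((1# - x * u) ⊕ x * u) * (r * p)
          ≈⟨ +-congˡ (*-congʳ (S.trans (minus-plus 1# (x * u)) (S.sym (minus-plus 1# u)))) ⟩
        y ⊕ ((1# - u) ⊕ u) * (r * p)
          ≈⟨ +-congˡ (*-congʳ (+-congˡ (S.trans (*-congʳ (minus-plus 1# x)) (*-identityˡ u)))) ⟨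
        y ⊕ ((1# - u) ⊕ (y ⊕ x) * u) * (r * p)
          ≈⟨ solve 6 (λ y x v u r p → y :+ (v :+ (y :+ x) :* u) :* (r :* p) :=
                y :+ r :* v :* p :+ r :* (p :* u) :* y :+ r :* (x :* u) :* p) S.refl y x (1# - u) u r p ⟩
        Q ⊕ r * (p * u) * y ⊕ r * (x * u) * p ∎)

      g-eq : g ⊕ r * ((p * u) * k) ≈ x * (f * f)
      g-eq = ∙-cancelʳ 1# _ _ (begin
        g ⊕ r * ((p * u) * k) ⊕ 1#   ≈⟨ solve 2 (λ g e → g :+ e :+ con 1 := con 1 :+ g :+ e) S.refl _ _ ⟩
        1# ⊕ g ⊕ r * ((p * u) * k)   ≈⟨ +-congʳ f≈1+g ⟨
        f ⊕ r * ((p * u) * k)        ≈⟨ f-eq ⟩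
        1# ⊕ x * (f * f)             ≈⟨ +-comm _ _ ⟩
        x * (f * f) ⊕ 1#             ∎)

      -- Replacing `y * g` by `Q * k` makes `Q` a common factor, and the cofactor is the left-hand
      -- side of `g-eq`; so k disappears without any division.
      Pg≈ : P * g ≈ x * Q * (f * f)
      Pg≈ = begin
        P * g                                ≈⟨ *-congʳ P≈ ⟩
        (Q ⊕ r * (p * u) * y) * g
          ≈⟨ solve 5 (λ Q r e y g → (Q :+ r :* e :* y) :* g := Q :* g :+ r :* e :* (y :* g)) S.refl Q r (p * u) y g ⟩
        Q * g ⊕ r * (p * u) * (y * g)        ≈⟨ +-congˡ (*-congˡ Qk≈yg) ⟨
        Q * g ⊕ r * (p * u) * (Q * k)
          ≈⟨ solve 5 (λ Q r e k g → Q :* g :+ r :* e :* (Q :* k) := Q :* (g :+ r :* (e :* k))) S.refl Q r (p * u) k g ⟩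
        Q * (g ⊕ r * ((p * u) * k))          ≈⟨ *-congˡ g-eq ⟩
        Q * (x * (f * f))
          ≈⟨ solve 3 (λ Q x h → Q :* (x :* h) := x :* Q :* h) S.refl Q x (f * f) ⟩
        x * Q * (f * f)                      ∎

      -- For f = 1 + z f², completing the square gives (1 - 2 z f)² = 1 - 4 z. The square root is
      -- thus written down in terms of f and never has to be constructed.
      z root : Carrier
      z = x * Q * i
      root = 1# - 2 · (z * f)

      f≈1+zf² : f ≈ 1# ⊕ z * (f * f)
      f≈1+zf² = begin
        f                       ≈⟨ f≈1+g ⟩
        1# ⊕ g                  ≈⟨ +-congˡ (S.trans (*-congʳ Pi≈1) (*-identityˡ g)) ⟨
        1# ⊕ P * i * g          ≈⟨ +-congˡ (solve 3 (λ P i g → P :* i :* g := P :* g :* i) S.refl P i g) ⟩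
        1# ⊕ P * g * i          ≈⟨ +-congˡ (*-congʳ Pg≈) ⟩
        1# ⊕ x * Q * (f * f) * i ≈⟨ +-congˡ (solve 3 (λ a i h → a :* h :* i := a :* i :* h) S.refl (x * Q) i (f * f)) ⟩
        1# ⊕ z * (f * f)        ∎

      ratio-correct : 4 · z * P ≈ 4 · (x * Q)
      ratio-correct = begin
        4 · z * P ≈⟨ solve 3 (λ a i P → let z = a :* i in
                        (z :+ (z :+ (z :+ (z :+ con 0)))) :* P :=
                        (P :* i) :* (a :+ (a :+ (a :+ (a :+ con 0))))) S.refl (x * Q) i P ⟩
        (P * i) * (4 · (x * Q)) ≈⟨ S.trans (*-congʳ Pi≈1) (*-identityˡ _) ⟩
        4 · (x * Q) ∎

      root² : root * root ≈ 1# - 4 · z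
      root² = ∙-cancelʳ (4 · z) _ _ (∙-cancelʳ (w * w) _ _ (begin
        root * root ⊕ 4 · z ⊕ w * w
          ≈⟨ +-assoc _ _ _ ⟩
        root * root ⊕ (4 · z ⊕ w * w)
          ≈⟨ +-congˡ (solve 2 (λ z f → let w = z :* f :+ (z :* f :+ con 0) in
               (z :+ (z :+ (z :+ (z :+ con 0)))) :+ w :* w :=
               (z :+ (z :+ (z :+ (z :+ con 0)))) :* (con 1 :+ z :* (f :* f))) S.refl z f) ⟩
        root * root ⊕ 4 · z * (1# ⊕ z * (f * f))
          ≈⟨ +-congˡ (*-congˡ f≈1+zf²) ⟨
        root * root ⊕ 4 · z * f
          ≈⟨ +-congˡ (solve 2 (λ z f → let w = z :* f :+ (z :* f :+ con 0) in
               (z :+ (z :+ (z :+ (z :+ con 0)))) :* f := con 1 :* (w :+ w)) S.refl z f) ⟩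
        root * root ⊕ 1# * (w ⊕ w)
          ≈⟨ +-congˡ (*-congʳ root+w≈1) ⟨
        root * root ⊕ (root ⊕ w) * (w ⊕ w)
          ≈⟨ solve 2 (λ s w → s :* s :+ (s :+ w) :* (w :+ w) := (s :+ w) :* (s :+ w) :+ w :* w) S.refl root w ⟩
        (root ⊕ w) * (root ⊕ w) ⊕ w * w
          ≈⟨ +-congʳ (S.trans (*-cong root+w≈1 root+w≈1) (*-identityˡ 1#)) ⟩
        1# ⊕ w * w
          ≈⟨ +-congʳ (minus-plus 1# (4 · z)) ⟨
        1# - 4 · z ⊕ 4 · z ⊕ w * w ∎))
        where
        w = 2 · (z * f)
        root+w≈1 : root ⊕ w ≈ 1#
        root+w≈1 = minus-plus 1# w

      f-correct : f * 2 · (x * Q) ≈ P * (1# - root)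
      f-correct = begin
        f * 2 · (x * Q)
          ≈⟨ *-identityˡ _ ⟨
        1# * (f * 2 · (x * Q))
          ≈⟨ *-congʳ Pi≈1 ⟨
        P * i * (f * 2 · (x * Q))
          ≈⟨ solve 4 (λ P i f a → P :* i :* (f :* (a :+ (a :+ con 0))) :=
                  P :* (a :* i :* f :+ (a :* i :* f :+ con 0))) S.refl P i f (x * Q) ⟩
        P * (2 · (z * f))
          ≈⟨ *-congˡ (∙-cancelʳ root _ _ (S.trans (+-comm _ _)
               (S.trans (minus-plus 1# (2 · (z * f))) (S.sym (minus-plus 1# root))))) ⟩
        P * (1# - root) ∎

-- The closed form for the series of trees.

module ClosedForm {c ℓ} (K : RawRing c ℓ) (q : RawRing.Carrier K) where

  open PowerSeries K

  -- `ratio` is the fraction under the square root. Quotients and the root are characterised by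
  -- their defining equations, so the formula makes sense over any raw ring.
  HasClosedForm : ℕ → ℕ → ℕ → Series → Set (c ⊔ˡ ℓ)
  HasClosedForm a b m f =
    let s = a ⊓ b
        t = a ⊔ b
        P = 1# ⊖ X ⊕ (1# ⊖ constant q) * (1# ⊖ X ^ s) * X ^ (m + t)
        Q = 1# ⊖ X ⊕ (1# ⊖ constant q) * (1# ⊖ X ^ (s ∸ 1)) * X ^ (m + t)
    in ∃₂ λ (ratio root : Series) →
         IsQuotient ratio (4 · (X * Q)) P ×
         IsSquareRoot root (1# ⊖ ratio) ×
         IsQuotient f (P * (1# ⊖ root)) (2 · (X * Q))

module Telescope {c ℓ} (R : CommutativeRing c ℓ) (q : CommutativeRing.Carrier R)
  (a′ b′ : ℕ) (ρ : Tree) (isNode-ρ : isNode ρ ≡ true) where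

  open Algebra.Properties.Ring (CommutativeRing.ring R) using (-0#≈0#)
  private
    module R = CommutativeRing R
    module S = CommutativeRing (SeriesRing.commutativeRing R)
    module E = Elimination (SeriesRing.commutativeRing R)
    r = R.1# R.- q
  open PowerSeries R.rawRing
  open Weights R q r (Elimination.minus-plus R R.1# q) a′ b′ ρ isNode-ρ
  open ClosedForm R.rawRing q
  open TreeSum R using (gf)
  open Exp S.semiring using (^-homo-*)
  open +-*-Solver using (_:=_; _:+_; con) renaming (solve to solveℕ)
  open SetoidReasoning S.setoid

  private
    y : Series
    y = S.1# ⊖ X

  telescope : ∀ j d → a′ ≡ j + d →
    y * 𝕂 j ⊕ constant r * (X ^ (d + suc (m + b′)) * 𝕂 b′) S.≈
    y * 𝕂 0 ⊕ constant r * (X ^ (a′ + suc (m + b′)) * 𝕂 b′)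
  telescope zero d a′≡ = S.reflexive (cong (λ i → y * 𝕂 0 ⊕ constant r * (X ^ (i + suc (m + b′)) * 𝕂 b′)) (≡.sym a′≡))
  telescope (suc j) d a′≡ = E.geometric-step X y (constant r) (X ^ (d + suc (m + b′))) (𝕂 b′) (𝕂 (suc j)) (𝕂 j) _
    (E.minus-plus S.1# X) (𝕂-suc j d a′≡) (telescope j (suc d) (≡.trans a′≡ (≡.sym (ℕ.+-suc j d))))

  𝕂-equation-at : ∀ {t} j d → a′ ≡ j + d → 𝕂 b′ S.≈ 𝕂 j → m + t ≡ d + suc (m + b′) →
    y * 𝕂 b′ ⊕ constant r * (X ^ (m + t) * 𝕂 b′) S.≈
    y * 𝕂 0 ⊕ constant r * (X ^ (a′ + suc (m + b′)) * 𝕂 b′)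
  𝕂-equation-at {t} j d a′≡ 𝕂≈ m+t≡ = begin
    y * 𝕂 b′ ⊕ constant r * (X ^ (m + t) * 𝕂 b′)
      ≈⟨ S.+-cong {y * 𝕂 b′} {y * 𝕂 j} (S.*-congˡ {y} 𝕂≈)
           (S.reflexive (cong (λ i → constant r * (X ^ i * 𝕂 b′)) m+t≡)) ⟩
    y * 𝕂 j ⊕ constant r * (X ^ (d + suc (m + b′)) * 𝕂 b′)
      ≈⟨ telescope j d a′≡ ⟩
    y * 𝕂 0 ⊕ constant r * (X ^ (a′ + suc (m + b′)) * 𝕂 b′) ∎

  -- The telescoping stops at j = min(a′, b′): at b′ because `𝕂 b′` is the series wanted, at a′
  -- because `𝕂` is constant from there on. The exponent left over is 1 + m + max(a′, b′) in both
  -- cases.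
  𝕂-equation : y * 𝕂 b′ ⊕ constant r * (X ^ (m + suc (a′ ⊔ b′)) * 𝕂 b′) S.≈
    y * 𝕂 0 ⊕ constant r * (X ^ (a′ + suc (m + b′)) * 𝕂 b′)
  𝕂-equation with ℕ.≤-total b′ a′
  ... | inj₁ b≤a = 𝕂-equation-at b′ (a′ ∸ b′) (≡.sym (ℕ.m+[n∸m]≡n b≤a)) S.refl
    (≡.trans (cong (λ i → m + suc i) (≡.trans (ℕ.m≥n⇒m⊔n≡m b≤a) (≡.sym (ℕ.m∸n+n≡m b≤a))))
      (solveℕ 3 (λ m d b → m :+ (con 1 :+ (d :+ b)) := d :+ (con 1 :+ (m :+ b))) refl m (a′ ∸ b′) b′))
  ... | inj₂ a≤b = 𝕂-equation-at a′ 0 (≡.sym (ℕ.+-identityʳ a′))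
    (subst (λ b → 𝕂 b S.≈ 𝕂 a′) (ℕ.m+[n∸m]≡n a≤b) (𝕂-constant (b′ ∸ a′)))
    (≡.trans (cong (λ i → m + suc i) (ℕ.m≤n⇒m⊔n≡n a≤b)) (ℕ.+-suc m b′))

  private
    s t : ℕ
    s = suc a′ ⊓ suc b′
    t = suc a′ ⊔ suc b′
    P Q F : Series
    P = S.1# ⊖ X ⊕ (S.1# ⊖ constant q) * (S.1# ⊖ X ^ s) * X ^ (m + t)
    Q = S.1# ⊖ X ⊕ (S.1# ⊖ constant q) * (S.1# ⊖ X ^ (s ∸ 1)) * X ^ (m + t)
    F = gf weight

  constant-r : constant r S.≈ S.1# ⊖ constant q
  constant-r zero = R.refl
  constant-r (suc _) = R.sym (R.-‿inverseʳ R.0#)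

  private
    r′ : Series
    r′ = S.1# ⊖ constant q

    exponent : a′ + suc (m + b′) ≡ m + t + (s ∸ 1)
    exponent with ℕ.≤-total b′ a′
    ... | inj₁ b≤a = ≡.trans (solveℕ 3 (λ m a b → a :+ (con 1 :+ (m :+ b)) := m :+ (con 1 :+ a) :+ b) refl m a′ b′)
      (cong₂ (λ t s → m + suc t + s) (≡.sym (ℕ.m≥n⇒m⊔n≡m b≤a)) (≡.sym (ℕ.m≥n⇒m⊓n≡n b≤a)))
    ... | inj₂ a≤b = ≡.trans (solveℕ 3 (λ m a b → a :+ (con 1 :+ (m :+ b)) := m :+ (con 1 :+ b) :+ a) refl m a′ b′)
      (cong₂ (λ t s → m + suc t + s) (≡.sym (ℕ.m≤n⇒m⊔n≡n a≤b)) (≡.sym (ℕ.m≤n⇒m⊓n≡m a≤b)))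

    r-term : constant r * (X ^ (a′ + suc (m + b′)) * 𝕂 b′) S.≈ r′ * ((X ^ (m + t) * X ^ (s ∸ 1)) * 𝕂 b′)
    r-term = begin
      constant r * (X ^ (a′ + suc (m + b′)) * 𝕂 b′)
        ≡⟨ cong (λ i → constant r * (X ^ i * 𝕂 b′)) exponent ⟩
      constant r * (X ^ (m + t + (s ∸ 1)) * 𝕂 b′)
        ≈⟨ S.*-cong {constant r} {r′} constant-r
             (S.*-congʳ {𝕂 b′} {X ^ (m + t + (s ∸ 1))} (^-homo-* X (m + t) (s ∸ 1))) ⟩
      r′ * ((X ^ (m + t) * X ^ (s ∸ 1)) * 𝕂 b′) ∎

    k-eq : y * 𝕂 b′ ⊕ r′ * (X ^ (m + t) * 𝕂 b′) S.≈ y * 𝕂 0 ⊕ r′ * ((X ^ (m + t) * X ^ (s ∸ 1)) * 𝕂 b′)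
    k-eq = begin
      y * 𝕂 b′ ⊕ r′ * (X ^ (m + t) * 𝕂 b′)
        ≈⟨ S.+-congˡ {y * 𝕂 b′} (S.*-congʳ {X ^ (m + t) * 𝕂 b′} {constant r} {r′} constant-r) ⟨
      y * 𝕂 b′ ⊕ constant r * (X ^ (m + t) * 𝕂 b′)
        ≈⟨ 𝕂-equation ⟩
      y * 𝕂 0 ⊕ constant r * (X ^ (a′ + suc (m + b′)) * 𝕂 b′)
        ≈⟨ S.+-congˡ {y * 𝕂 0} r-term ⟩
      y * 𝕂 0 ⊕ r′ * ((X ^ (m + t) * X ^ (s ∸ 1)) * 𝕂 b′) ∎

    f-eq : F ⊕ r′ * ((X ^ (m + t) * X ^ (s ∸ 1)) * 𝕂 b′) S.≈ S.1# ⊕ X * (F * F)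
    f-eq = S.trans {F ⊕ r′ * ((X ^ (m + t) * X ^ (s ∸ 1)) * 𝕂 b′)}
      (S.+-congˡ {F} (S.sym {constant r * (X ^ (a′ + suc (m + b′)) * 𝕂 b′)} r-term)) gf-weight-product

    head-X* : ∀ f → (X * f) 0 R.≈ R.0#
    head-X* f = R.trans (R.+-identityʳ _) (R.zeroˡ _)

    head≈1 : ∀ f → (S.1# ⊖ X ⊕ f * X ^ (m + t)) 0 R.≈ R.1#
    head≈1 f = R.trans (R.+-cong (R.trans (R.+-congˡ -0#≈0#) (R.+-identityʳ _)) vanish) (R.+-identityʳ _)
      where
      vanish : (f * X ^ (m + t)) 0 R.≈ R.0#
      vanish = R.trans (R.+-identityʳ _) (R.trans (R.*-congˡ
        (R.trans (R.reflexive (cong (λ i → (X ^ i) 0) (ℕ.+-suc m (a′ ⊔ b′)))) (head-X* (X ^ (m + (a′ ⊔ b′))))))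
        (R.zeroʳ _))

    P₀≈1 : P 0 R.≈ R.1#
    P₀≈1 = head≈1 (r′ * (S.1# ⊖ X ^ s))

    Q₀≈1 : Q 0 R.≈ R.1#
    Q₀≈1 = head≈1 (r′ * (S.1# ⊖ X ^ (s ∸ 1)))

    module P⁻¹ = SeriesRing.Inverse R P P₀≈1

    -- The exponents agree by computation: `s` reduces to a successor, so `X ^ s` unfolds to the
    -- product `x * u` of `Quadratic`.
    module Z = E.Quadratic.Solution X r′ (X ^ (m + t)) (X ^ (s ∸ 1)) (𝕂 b′) (𝕂 0) F P⁻¹.inverse
      gf-weight k-eq f-eq P⁻¹.*-inverseʳ

    head-2·z*F : (2 · (Z.z * F)) 0 R.≈ R.0#
    head-2·z*F = R.trans (R.+-cong z*F₀ (R.trans (R.+-identityʳ _) z*F₀)) (R.+-identityʳ _)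
      where
      z₀ : Z.z 0 R.≈ R.0#
      z₀ = R.trans (R.+-identityʳ _) (R.trans (R.*-congʳ (head-X* Q)) (R.zeroˡ _))
      z*F₀ : (Z.z * F) 0 R.≈ R.0#
      z*F₀ = R.trans (R.+-identityʳ _) (R.trans (R.*-congʳ z₀) (R.zeroˡ _))

    root₀≈1 : Z.root 0 R.≈ R.1#
    root₀≈1 = R.trans (R.+-congˡ (R.trans (R.-‿cong head-2·z*F) -0#≈0#)) (R.+-identityʳ _)

    -- The denominator has constant term zero, so it is the next coefficient that separates it from
    -- the zero series.
    coefficient-1 : (2 · (X * Q)) 1 R.≈ R.1# R.+ R.1#
    coefficient-1 = R.+-cong XQ₁ (R.trans (R.+-identityʳ _) XQ₁)
      where
      XQ₁ : (X * Q) 1 R.≈ R.1#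
      XQ₁ = R.trans (SeriesRing.X-* R Q 0) Q₀≈1

  closedForm : ¬ R.1# R.+ R.1# R.≈ R.0# → HasClosedForm (suc a′) (suc b′) m F
  closedForm 2≉0 = 4 · Z.z , Z.root
    , ((λ P≈0 → 1≉0 (R.trans (R.sym P₀≈1) (P≈0 0))) , Z.ratio-correct)
    , (Z.root² , root₀≈1)
    , ((λ 2XQ≈0 → 2≉0 (R.trans (R.sym coefficient-1) (2XQ≈0 1))) , Z.f-correct)
    where
    1≉0 : ¬ R.1# R.≈ R.0#
    1≉0 1≈0 = 2≉0 (R.trans (R.+-cong 1≈0 1≈0) (R.+-identityˡ R.0#))

-- The word of a tree.

mutual
  blocks : Tree → ℕ
  blocks leaf = 0
  blocks t@(node _ _) = suc (laterBlocks t)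

  -- The number of labels consumed when the first block is already open, as it is for a right child.
  laterBlocks : Tree → ℕ
  laterBlocks leaf = 0
  laterBlocks (node l r) = blocks l + laterBlocks r

-- The word of t in front of w, where c is the label of the first block of t and
-- the labels 1, …, n are already in use.
enc : ℕ → ℕ → Tree → List ℕ → List ℕ
enc c n leaf w = w
enc c n (node l r) w = c ∷ enc (suc n) (suc n) l (enc c (n + blocks l) r w)

word : Tree → List ℕ
word t = enc 1 1 t []

length-enc : ∀ c n t w → length (enc c n t w) ≡ size t + length w
length-enc c n leaf w = refl
length-enc c n (node l r) w = cong suc (trans (length-enc (suc n) (suc n) l _)
  (trans (cong (size l +_) (length-enc c (n + blocks l) r w)) (sym (ℕ.+-assoc (size l) (size r) _))))

-- A condition on the letter that follows an encoded tree; the end of the word meets every such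
-- condition.
Head : (ℕ → Set) → List ℕ → Set
Head P [] = ⊤
Head P (x ∷ _) = P x

head-enc : ∀ {P : ℕ → Set} {c} n t w → P c → Head P w → Head P (enc c n t w)
head-enc n leaf w Pc Pw = Pw
head-enc n (node _ _) w Pc Pw = Pc

map-head : ∀ {P Q : ℕ → Set} → (∀ {x} → P x → Q x) → ∀ w → Head P w → Head Q w
map-head f [] _ = tt
map-head f (x ∷ w) p = f p

private
  below : ∀ {n x} → x ≤ n → x ≤ suc n × x ≢ suc n
  below x≤n = ℕ.m≤n⇒m≤1+n x≤n , λ { refl → ℕ.1+n≰n x≤n }

-- A following letter `c` could be read as part of the tree, so `w` must not begin with it. The
-- bound `x ≤ n` passes this condition on to the gap, whose own label is n + 1.
enc-injective : ∀ {c n} t t′ {w w′} → c ≤ n →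
  Head (λ x → x ≤ n × x ≢ c) w → Head (λ x → x ≤ n × x ≢ c) w′ →
  enc c n t w ≡ enc c n t′ w′ → t ≡ t′ × w ≡ w′
enc-injective leaf leaf c≤n hw hw′ eq = refl , eq
enc-injective leaf (node l r) c≤n hw hw′ refl = contradiction refl (proj₂ hw)
enc-injective (node l r) leaf c≤n hw hw′ refl = contradiction refl (proj₂ hw′)
enc-injective {c} {n} (node l r) (node l′ r′) {w} {w′} c≤n hw hw′ eq
  with refl , eq′ ← enc-injective l l′ ℕ.≤-refl
         (head-enc _ r w (below c≤n) (map-head (λ p → below (proj₁ p)) w hw))
         (head-enc _ r′ w′ (below c≤n) (map-head (λ p → below (proj₁ p)) w′ hw′)) (∷-injectiveʳ eq)
  with refl , refl ← enc-injective r r′ (ℕ.m≤n⇒m≤n+o (blocks l) c≤n)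
         (map-head (λ (p , q) → ℕ.m≤n⇒m≤n+o (blocks l) p , q) w hw)
         (map-head (λ (p , q) → ℕ.m≤n⇒m≤n+o (blocks l) p , q) w′ hw′) eq′
  = refl , refl


word-injective : ∀ {t t′} → word t ≡ word t′ → t ≡ t′
word-injective {t} {t′} eq = proj₁ (enc-injective t t′ ℕ.≤-refl tt tt eq)

-- Non-crossing canonical words as the words of a stack automaton.

data Pop (x : ℕ) : List ℕ → List ℕ → Set where
  here  : ∀ {S} → Pop x (x ∷ S) S
  -- The blocks above `x` are discarded: reading `x` closes them.
  there : ∀ {y S S′} → Pop x S S′ → Pop x (y ∷ S) S′

-- The words read by an automaton that has already seen the labels 1, …, n and
-- keeps the blocks that are still allowed to grow on a stack S.
data Valid : List ℕ → ℕ → List ℕ → Set where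
  done : ∀ {S n} → Valid S n []
  push : ∀ {S n w} → Valid (suc n ∷ S) (suc n) w → Valid S n (suc n ∷ w)
  pop  : ∀ {S S′ n x w} → Pop x S S′ → Valid (x ∷ S′) n w → Valid S n (x ∷ w)

pop-⊆ : ∀ {x S S′ T} → Pop x S S′ → S ⊆ T → ∃ λ T′ → Pop x T T′ × S′ ⊆ T′
pop-⊆ p (y ∷ʳ S⊆T) with T′ , p′ , S′⊆T′ ← pop-⊆ p S⊆T = T′ , there p′ , S′⊆T′
pop-⊆ here (refl ∷ S⊆T) = _ , here , S⊆T
pop-⊆ (there p) (refl ∷ S⊆T) with T′ , p′ , S′⊆T′ ← pop-⊆ p S⊆T = T′ , there p′ , S′⊆T′

-- More open blocks allow more words. This is needed because the block opened by a tree is still on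
-- the stack when the surrounding word goes on.
valid-⊆ : ∀ {S T n w} → S ⊆ T → Valid S n w → Valid T n w
valid-⊆ S⊆T done = done
valid-⊆ S⊆T (push v) = push (valid-⊆ (refl ∷ S⊆T) v)
valid-⊆ S⊆T (pop p v) with T′ , p′ , S′⊆T′ ← pop-⊆ p S⊆T = pop p′ (valid-⊆ (refl ∷ S′⊆T′) v)

mutual
  enc-valid : ∀ {c S n w} t → Valid (c ∷ S) (n + laterBlocks t) w → Valid (c ∷ S) n (enc c n t w)
  enc-valid {c} {S} {n} {w} leaf v = subst (λ k → Valid (c ∷ S) k w) (ℕ.+-identityʳ n) v
  enc-valid {c} {S} {n} {w} (node l r) v = pop here (gap-valid l (enc-valid r
    (subst (λ k → Valid (c ∷ S) k w) (sym (ℕ.+-assoc n (blocks l) (laterBlocks r))) v)))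

  gap-valid : ∀ {S n w} t → Valid S (n + blocks t) w → Valid S n (enc (suc n) (suc n) t w)
  gap-valid {S} {n} {w} leaf v = subst (λ k → Valid S k w) (ℕ.+-identityʳ n) v
  gap-valid {S} {n} {w} (node l r) v = push (gap-valid l (enc-valid r (valid-⊆ (suc n ∷ʳ ⊆-refl)
    (subst (λ k → Valid S k w)
      (trans (ℕ.+-suc n _) (cong suc (sym (ℕ.+-assoc n (blocks l) (laterBlocks r))))) v))))

word-valid : ∀ t → Valid [] 0 (word t)
word-valid t = gap-valid t done

-- The rest of the word consists of one continuation, possibly `leaf`, for each open block, from the
-- top of the stack down.
Remaining : List ℕ → ℕ → List ℕ → Set
Remaining [] n w = w ≡ []
Remaining (c ∷ S) n w = ∃₂ λ t w′ → w ≡ enc c n t w′ × Remaining S (n + laterBlocks t) w′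

subst-remaining : ∀ {S n n′ w} → n ≡ n′ → Remaining S n w → Remaining S n′ w
subst-remaining refl rem = rem

remaining-[] : ∀ S n → Remaining S n []
remaining-[] [] n = refl
remaining-[] (c ∷ S) n = leaf , [] , refl , remaining-[] S _

remaining-pop : ∀ {x S S′ n w} l → Pop x S S′ → Remaining (x ∷ S′) (n + blocks l) w →
  Remaining S n (x ∷ enc (suc n) (suc n) l w)
remaining-pop {n = n} l here (r , w′ , refl , rest) = node l r , w′ , refl ,
  subst-remaining (ℕ.+-assoc n (blocks l) (laterBlocks r)) rest
remaining-pop {n = n} l (there p) rest = leaf , _ , refl ,
  subst-remaining (sym (ℕ.+-identityʳ n)) (remaining-pop l p rest)

-- The next letter decides. A new label begins a tree in the current gap, whereas an old label ends
-- the gap with `leaf` and resumes its own block, every block above it being continued by `leaf`.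
parse : ∀ {S n w} → Valid S n w →
  ∃₂ λ t w′ → w ≡ enc (suc n) (suc n) t w′ × Remaining S (n + blocks t) w′
parse {S} {n} done = leaf , [] , refl , remaining-[] S _
parse {S} {n} (push v) with l , _ , refl , r , w′ , refl , rest ← parse v = node l r , w′ , refl ,
  subst-remaining (trans (cong suc (ℕ.+-assoc n (blocks l) (laterBlocks r))) (sym (ℕ.+-suc n _))) rest
parse {S} {n} (pop p v) with l , _ , refl , rest ← parse v = leaf , _ , refl ,
  subst-remaining (sym (ℕ.+-identityʳ n)) (remaining-pop l p rest)

Stack : ℕ → List ℕ → Set
Stack n S = AllPairs _>_ S × All (λ x → 1 ≤ x × x ≤ n) S

stack-push : ∀ {n S} → Stack n S → Stack (suc n) (suc n ∷ S)
stack-push (dec , bd) = All.map (λ (_ , x≤n) → s≤s x≤n) bd ∷ dec ,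
  (s≤s z≤n , ℕ.≤-refl) ∷ All.map (λ (p , q) → p , ℕ.m≤n⇒m≤1+n q) bd

stack-pop : ∀ {x n S S′} → Pop x S S′ → Stack n S → Stack n (x ∷ S′)
stack-pop here s = s
stack-pop (there p) (_ ∷ dec , _ ∷ bd) = stack-pop p (dec , bd)

pop-∈ : ∀ {x S S′} → Pop x S S′ → ∀ {y} → y ∈ x ∷ S′ → y ∈ S
pop-∈ here y∈ = y∈
pop-∈ (there p) y∈ = there (pop-∈ p y∈)

∈-pop : ∀ {x S} → x ∈ S → ∃ (Pop x S)
∈-pop (here refl) = _ , here
∈-pop (there x∈) with S′ , p ← ∈-pop x∈ = S′ , there p

pop-≤ : ∀ {x n S S′ y} → Pop x S S′ → Stack n S → y ∈ x ∷ S′ → y ≤ x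
pop-≤ p s (here refl) = ℕ.≤-refl
pop-≤ p s (there y∈) with >y ∷ _ , _ ← stack-pop p s = ℕ.<⇒≤ (All.lookup >y y∈)

≤-pop : ∀ {x n S S′ y} → Pop x S S′ → Stack n S → y ∈ S → y ≤ x → y ∈ x ∷ S′
≤-pop here s y∈ y≤x = y∈
≤-pop (there p) (dec ∷ _ , _) (here refl) y≤x =
  contradiction (All.lookup dec (pop-∈ p (here refl))) (ℕ.≤⇒≯ y≤x)
≤-pop (there p) (_ ∷ dec , _ ∷ bd) (there y∈) y≤x = ≤-pop p (dec , bd) y∈ y≤x

stack-≤ : ∀ {n S x} → Stack n S → x ∈ S → x ≤ n
stack-≤ (_ , bd) x∈ = proj₂ (All.lookup bd x∈)

valid-letters : ∀ {S n w x} → Valid S n w → x ∈ w → x ∈ S ⊎ n < x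
valid-letters (push v) (here refl) = inj₂ ℕ.≤-refl
valid-letters (push v) (there x∈) with valid-letters v x∈
... | inj₁ (here refl) = inj₂ ℕ.≤-refl
... | inj₁ (there x∈S) = inj₁ x∈S
... | inj₂ n<x = inj₂ (ℕ.<⇒≤ n<x)
valid-letters (pop p v) (here refl) = inj₁ (pop-∈ p (here refl))
valid-letters (pop p v) (there x∈) with valid-letters v x∈
... | inj₁ x∈S = inj₁ (pop-∈ p x∈S)
... | inj₂ n<x = inj₂ n<x

valid-letters-≤ : ∀ {S n w x} → Valid S n w → x ≤ n → x ∈ w → x ∈ S
valid-letters-≤ v x≤n x∈w with valid-letters v x∈w
... | inj₁ x∈S = x∈S
... | inj₂ n<x = contradiction n<x (ℕ.≤⇒≯ x≤n)

-- A block above x on the stack is closed when x is read.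
valid-stack : ∀ {S n w x y} → Valid S n w → Stack n S → x ∈ S → y ∈ S → x < y → ¬ (x ∷ y ∷ []) ⊆ w
valid-stack (push v) s x∈ y∈ x<y (refl ∷ _) = ℕ.1+n≰n (stack-≤ s x∈)
valid-stack (push v) s x∈ y∈ x<y (_ ∷ʳ sub) = valid-stack v (stack-push s) (there x∈) (there y∈) x<y sub
valid-stack (pop p v) s x∈ y∈ x<y (refl ∷ sub) =
  ℕ.<⇒≱ x<y (pop-≤ p s (valid-letters-≤ v (stack-≤ s y∈) (to∈ sub)))
valid-stack (pop p v) s x∈ y∈ x<y (_ ∷ʳ sub) = valid-stack v (stack-pop p s)
  (valid-letters-≤ v (stack-≤ s x∈) (to∈ sub)) (valid-letters-≤ v (stack-≤ s y∈) (to∈ (∷ˡ⁻ sub))) x<y sub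

-- A block opened later than `x` lies above `x` on the stack, so it cannot be used again after `x`
-- is read.
valid-new : ∀ {S n w x y} → Valid S n w → Stack n S → x ∈ S → n < y → ¬ (y ∷ x ∷ y ∷ []) ⊆ w
valid-new (push v) s x∈ n<y (refl ∷ sub) =
  valid-stack v (stack-push s) (there x∈) (here refl) (s≤s (stack-≤ s x∈)) sub
valid-new {y = y} (push {n = n} v) s x∈ n<y (_ ∷ʳ sub) with ℕ.m≤n⇒m<n∨m≡n n<y
... | inj₁ 1+n<y = valid-new v (stack-push s) (there x∈) 1+n<y sub
... | inj₂ refl = valid-stack v (stack-push s) (there x∈) (here refl) (s≤s (stack-≤ s x∈)) (∷ˡ⁻ sub)
valid-new (pop p v) s x∈ n<y (refl ∷ sub) = ℕ.<⇒≱ n<y (stack-≤ s (pop-∈ p (here refl)))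
valid-new (pop p v) s x∈ n<y (_ ∷ʳ sub) =
  valid-new v (stack-pop p s) (valid-letters-≤ v (stack-≤ s x∈) (to∈ (∷ˡ⁻ sub))) n<y sub

-- When the first letter of a pattern a b a b is read, a is on top of the stack. Then b is either
-- still open, hence not above a, or opened later, hence unable to surround the second a.
valid⇒nonCrossing : ∀ {S n w} → Valid S n w → Stack n S → NonCrossing w
valid⇒nonCrossing (push v) s (_ , _ , a<b , (refl ∷ sub)) = valid-new v (stack-push s) (here refl) a<b sub
valid⇒nonCrossing (push v) s (a , b , a<b , (_ ∷ʳ sub)) = valid⇒nonCrossing v (stack-push s) (a , b , a<b , sub)
valid⇒nonCrossing (pop p v) s (_ , _ , a<b , (refl ∷ sub)) with valid-letters v (to∈ sub)
... | inj₁ b∈ = ℕ.<⇒≱ a<b (pop-≤ p s b∈)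
... | inj₂ n<b = valid-new v (stack-pop p s) (here refl) n<b sub
valid⇒nonCrossing (pop p v) s (a , b , a<b , (_ ∷ʳ sub)) = valid⇒nonCrossing v (stack-pop p s) (a , b , a<b , sub)

-- RestrictedGrowth for the continuation w of a word with letters 1, …, n.
GrowthFrom : ℕ → List ℕ → Set
GrowthFrom n w = ∀ i → 1 ≤ lookup w i ×
  (∀ c → n < c → c < lookup w i → ∃ λ i′ → i′ Fin.< i × lookup w i′ ≡ c)

valid⇒growth : ∀ {S n w} → Valid S n w → Stack n S → GrowthFrom n w
valid⇒growth (push v) s Fin.zero = s≤s z≤n , λ c n<c c<1+n → contradiction n<c (ℕ.<⇒≱ c<1+n)
valid⇒growth (push {n = n} v) s (Fin.suc i) with pos , earlier ← valid⇒growth v (stack-push s) i = pos , go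
  where
  go : ∀ c → n < c → c < _ → ∃ λ i′ → i′ Fin.< Fin.suc i × _ ≡ c
  go c n<c c<x with ℕ.m≤n⇒m<n∨m≡n n<c
  ... | inj₂ refl = Fin.zero , s≤s z≤n , refl
  ... | inj₁ 1+n<c with i′ , i′<i , eq ← earlier c 1+n<c c<x = Fin.suc i′ , s≤s i′<i , eq
valid⇒growth (pop p v) s Fin.zero with (1≤x , x≤n) ∷ _ ← proj₂ (stack-pop p s) =
  1≤x , λ c n<c c<x → contradiction (ℕ.<-≤-trans (ℕ.<-trans n<c c<x) x≤n) (ℕ.<-irrefl refl)
valid⇒growth (pop p v) s (Fin.suc i) with pos , earlier ← valid⇒growth v (stack-pop p s) i =
  pos , λ c n<c c<x → let i′ , i′<i , eq = earlier c n<c c<x in Fin.suc i′ , s≤s i′<i , eq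

growth-head : ∀ {n x w} → GrowthFrom n (x ∷ w) → x ≤ suc n
growth-head growth = ℕ.≮⇒≥ λ 1+n<x → case proj₂ (growth Fin.zero) _ ℕ.≤-refl 1+n<x of λ ()

growth-push : ∀ {n w} → GrowthFrom n (suc n ∷ w) → GrowthFrom (suc n) w
growth-push {n} {w} growth i with pos , earlier ← growth (Fin.suc i) = pos , go
  where
  go : ∀ c → suc n < c → c < lookup w i → ∃ λ i′ → i′ Fin.< i × lookup w i′ ≡ c
  go c n<c c<x with earlier c (ℕ.<⇒≤ n<c) c<x
  ... | Fin.zero , _ , refl = contradiction n<c (ℕ.<-irrefl refl)
  ... | Fin.suc i′ , s≤s i′<i , eq = i′ , i′<i , eq

growth-pop : ∀ {n x w} → x ≤ n → GrowthFrom n (x ∷ w) → GrowthFrom n w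
growth-pop {n} {w = w} x≤n growth i with pos , earlier ← growth (Fin.suc i) = pos , go
  where
  go : ∀ c → n < c → c < lookup w i → ∃ λ i′ → i′ Fin.< i × lookup w i′ ≡ c
  go c n<c c<x with earlier c n<c c<x
  ... | Fin.zero , _ , refl = contradiction x≤n (ℕ.<⇒≱ n<c)
  ... | Fin.suc i′ , s≤s i′<i , eq = i′ , i′<i , eq

-- The hypotheses record how much of a forbidden pattern a b a b has been read: nothing
-- (`NonCrossing w`), a (the condition on y x y), or a b (the condition on x y for letters of the
-- stack). The first condition says that only letters on the stack can return.
valid : ∀ {S n} w → Stack n S → GrowthFrom n w →
  (∀ {x} → 1 ≤ x → x ≤ n → x ∈ w → x ∈ S) →
  (∀ {x y} → x ∈ S → y ∈ S → x < y → ¬ (x ∷ y ∷ []) ⊆ w) →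
  (∀ {x y} → 1 ≤ x → x ≤ n → x < y → ¬ (y ∷ x ∷ y ∷ []) ⊆ w) →
  NonCrossing w → Valid S n w
valid [] _ _ _ _ _ _ = done
valid {S} {n} (x ∷ w) s growth closed sorted new nc with ℕ.m≤n⇒m<n∨m≡n (growth-head growth)
... | inj₂ refl = push (valid w (stack-push s) (growth-push growth) closed′ sorted′ new′ nc′)
  where
  closed′ : ∀ {y} → 1 ≤ y → y ≤ suc n → y ∈ w → y ∈ suc n ∷ S
  closed′ 1≤y y≤1+n y∈ with ℕ.m≤n⇒m<n∨m≡n y≤1+n
  ... | inj₁ (s≤s y≤n) = there (closed 1≤y y≤n (there y∈))
  ... | inj₂ refl = here refl
  sorted′ : ∀ {y z} → y ∈ suc n ∷ S → z ∈ suc n ∷ S → y < z → ¬ (y ∷ z ∷ []) ⊆ w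
  sorted′ (here refl) (here refl) y<z _ = ℕ.<-irrefl refl y<z
  sorted′ (here refl) (there z∈) y<z _ = ℕ.<⇒≱ y<z (ℕ.m≤n⇒m≤1+n (stack-≤ s z∈))
  sorted′ (there y∈) (here refl) y<z sub =
    new (proj₁ (All.lookup (proj₂ s) y∈)) (stack-≤ s y∈) y<z (refl ∷ sub)
  sorted′ (there y∈) (there z∈) y<z sub = sorted y∈ z∈ y<z (_ ∷ʳ sub)
  new′ : ∀ {y z} → 1 ≤ y → y ≤ suc n → y < z → ¬ (z ∷ y ∷ z ∷ []) ⊆ w
  new′ 1≤y y≤1+n y<z sub with ℕ.m≤n⇒m<n∨m≡n y≤1+n
  ... | inj₁ (s≤s y≤n) = new 1≤y y≤n y<z (_ ∷ʳ sub)
  ... | inj₂ refl = nc (_ , _ , y<z , refl ∷ sub)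
  nc′ : NonCrossing w
  nc′ (a , b , a<b , sub) = nc (a , b , a<b , _ ∷ʳ sub)
... | inj₁ (s≤s x≤n) with S′ , p ← ∈-pop (closed (proj₁ (growth Fin.zero)) x≤n (here refl)) =
  pop p (valid w (stack-pop p s) (growth-pop x≤n growth) closed′
    (λ y∈ z∈ y<z sub → sorted (pop-∈ p y∈) (pop-∈ p z∈) y<z (_ ∷ʳ sub))
    (λ 1≤y y≤n y<z sub → new 1≤y y≤n y<z (_ ∷ʳ sub))
    λ (a , b , a<b , sub) → nc (a , b , a<b , _ ∷ʳ sub))
  where
  closed′ : ∀ {y} → 1 ≤ y → y ≤ n → y ∈ w → y ∈ x ∷ S′
  closed′ {y} 1≤y y≤n y∈ with y ℕ.≤? x | closed 1≤y y≤n (there y∈)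
  ... | yes y≤x | y∈S = ≤-pop p s y∈S y≤x
  -- A letter `y` discarded by this pop cannot return: reading `x` and then `y` would complete a
  -- crossing.
  ... | no y≰x | y∈S = contradiction (refl ∷ from∈ y∈) (sorted (pop-∈ p (here refl)) y∈S (ℕ.≰⇒> y≰x))

restrictedGrowth⇒growth : ∀ π → RestrictedGrowth π → GrowthFrom 0 π
restrictedGrowth⇒growth π rg i with pos , earlier ← rg i = pos , λ where
  (suc c) _ c<x → let c<pred = ℕ.pred-mono-≤ c<x ; i′ , i′<i , eq = earlier (fromℕ< c<pred) in
    i′ , i′<i , trans eq (cong suc (Fin.toℕ-fromℕ< c<pred))

growth⇒restrictedGrowth : ∀ π → GrowthFrom 0 π → RestrictedGrowth π
growth⇒restrictedGrowth π g i with pos , earlier ← g i = pos , λ c →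
  earlier (suc (toℕ c)) (s≤s z≤n)
    (subst (suc (suc (toℕ c)) ≤_) (ℕ.suc-pred (lookup π i) {{>-nonZero pos}}) (s≤s (Fin.toℕ<n c)))

length-word : ∀ t → length (word t) ≡ size t
length-word t = trans (length-enc 1 1 t []) (ℕ.+-identityʳ (size t))

growth-word : ∀ t → GrowthFrom 0 (word t)
growth-word t = valid⇒growth (word-valid t) ([] , [])

word-isNC : ∀ t → IsNC (size t) (word t)
word-isNC t = isNC (length-word t)
  (growth⇒canonical (word t) (growth⇒restrictedGrowth (word t) (growth-word t)))
  (valid⇒nonCrossing (word-valid t) ([] , []))

isNC⇒word : ∀ {n π} → IsNC n π → ∃ λ t → size t ≡ n × word t ≡ π
isNC⇒word {n} {π} (isNC len canonical nonCrossing)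
  with t , _ , refl , refl ← parse (valid {[]} {0} π ([] , [])
         (restrictedGrowth⇒growth π (canonical⇒growth π canonical))
         (λ 1≤x x≤0 → contradiction (ℕ.≤-trans 1≤x x≤0) λ ()) (λ ())
         (λ 1≤x x≤0 → contradiction (ℕ.≤-trans 1≤x x≤0) λ ()) nonCrossing)
  = t , trans (sym (length-word t)) len , refl

-- The words of the trees of size n are exactly the members of NC n.

node-injective : ∀ {l l′ r r′} → node l r ≡ node l′ r′ → l ≡ l′ × r ≡ r′
node-injective refl = refl , refl

∈-trees : ∀ t → t ∈ trees (size t)
∈-trees leaf = here refl
∈-trees (node l r) = subst (node l r ∈_) (sym (trees-suc (size l + size r)))
  (∈-concat⁺′ (∈-cartesianProductWith⁺ node
      (subst (λ k → l ∈ trees k) (sym i≡) (∈-trees l))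
      (subst (λ k → r ∈ trees k) (sym (trans (cong (size l + size r ∸_) i≡) (ℕ.m+n∸m≡n (size l) (size r)))) (∈-trees r)))
    (∈-tabulate⁺ {f = nodes (size l + size r)} i))
  where
  i = fromℕ< (s≤s (ℕ.m≤m+n (size l) (size r)))
  i≡ : toℕ i ≡ size l
  i≡ = Fin.toℕ-fromℕ< _

nodesWithin : ∀ d n → Fin (suc n) → List Tree
nodesWithin d n i = cartesianProductWith node (treesWithin d (toℕ i)) (treesWithin d (n ∸ toℕ i))

size-treesWithin : ∀ d n {t} → t ∈ treesWithin d n → size t ≡ n
size-treesWithin _ zero (here refl) = refl
size-treesWithin (suc d) (suc n) t∈
  with _ , t∈ts , ts∈ ← ∈-concat⁻′ (tabulate (nodesWithin d n)) t∈
  with i , refl ← ∈-tabulate⁻ {f = nodesWithin d n} ts∈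
  with l , r , l∈ , r∈ , refl ← ∈-cartesianProductWith⁻ node (treesWithin d (toℕ i)) (treesWithin d (n ∸ toℕ i)) t∈ts
  = cong suc (trans (cong₂ _+_ (size-treesWithin d (toℕ i) l∈) (size-treesWithin d (n ∸ toℕ i) r∈))
      (ℕ.m+[n∸m]≡n (s≤s⁻¹ (Fin.toℕ<n i))))

treesWithin-unique : ∀ d n → Unique (treesWithin d n)
treesWithin-unique _ zero = [] ∷ []
treesWithin-unique zero (suc n) = []
treesWithin-unique (suc d) (suc n) = Unique.concat⁺
  (All.tabulate⁺ λ i → Unique.cartesianProductWith⁺ node node-injective
    (treesWithin-unique d (toℕ i)) (treesWithin-unique d (n ∸ toℕ i)))
  (AllPairs.tabulate⁺ {f = nodesWithin d n} λ {i} {j} i≢j (t∈ᵢ , t∈ⱼ) → disjoint i j i≢j t∈ᵢ t∈ⱼ)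
  where
  disjoint : ∀ (i j : Fin (suc n)) → i ≢ j → ∀ {t} →
    t ∈ nodesWithin d n i →
    ¬ t ∈ nodesWithin d n j
  disjoint i j i≢j t∈ᵢ t∈ⱼ
    with _ , _ , l∈ᵢ , _ , refl ← ∈-cartesianProductWith⁻ node (treesWithin d (toℕ i)) (treesWithin d (n ∸ toℕ i)) t∈ᵢ
    with _ , _ , l∈ⱼ , _ , refl ← ∈-cartesianProductWith⁻ node (treesWithin d (toℕ j)) (treesWithin d (n ∸ toℕ j)) t∈ⱼ
    = i≢j (Fin.toℕ-injective (trans (sym (size-treesWithin d (toℕ i) l∈ᵢ)) (size-treesWithin d (toℕ j) l∈ⱼ)))

isNC⇒∈-words : ∀ {n π} → IsNC n π → π ∈ map word (trees n)
isNC⇒∈-words π-NC = go (isNC⇒word π-NC)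
  where
  go : ∀ {n π} → (∃ λ t → size t ≡ n × word t ≡ π) → π ∈ map word (trees n)
  go (t , refl , refl) = ∈-map⁺ word (∈-trees t)

∈-words⇒isNC : ∀ {n π} → π ∈ map word (trees n) → IsNC n π
∈-words⇒isNC {n} π∈ with t , t∈ , refl ← ∈-map⁻ word π∈ =
  subst (λ k → IsNC k (word t)) (size-treesWithin n n t∈) (word-isNC t)

-- Both lists are free of repetitions, so having the same members already makes them permutations of
-- each other, and sums over them agree.
NC↭words : ∀ n → NC n ↭ map word (trees n)
NC↭words n = ∼bag⇒↭ (unique∧set⇒bag (NC-unique n)
  (Unique.map⁺ word-injective (treesWithin-unique n n))
  (mk⇔ (isNC⇒∈-words ∘ Equivalence.to (∈-NC {n})) (Equivalence.from (∈-NC {n}) ∘ ∈-words⇒isNC)))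

-- Order isomorphism of words.

sameOrder-sym : ∀ {x y x′ y′} → SameOrder (x , y) (x′ , y′) → SameOrder (y , x) (y′ , x′)
sameOrder-sym ((a , b) , (c , d)) = (b , a) , (d , c)

sameOrder-+⁺ : ∀ k {x y x′ y′} → SameOrder (x , y) (x′ , y′) → SameOrder (x , k + y) (x′ , k + y′)
sameOrder-+⁺ k ((a , b) , (c , d)) =
  (ℕ.+-monoʳ-< k ∘ a , b ∘ ℕ.+-cancelˡ-< k _ _) , (cong (k +_) ∘ c , d ∘ ℕ.+-cancelˡ-≡ k _ _)

sameOrder-+⁻ : ∀ k {x y x′ y′} → SameOrder (x , k + y) (x′ , k + y′) → SameOrder (x , y) (x′ , y′)
sameOrder-+⁻ k ((a , b) , (c , d)) =
  (ℕ.+-cancelˡ-< k _ _ ∘ a , b ∘ ℕ.+-monoʳ-< k) , (ℕ.+-cancelˡ-≡ k _ _ ∘ c , d ∘ cong (k +_))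

SameOrders : List (ℕ × ℕ) → Set
SameOrders ps = ∀ {p p′} → p ∈ ps → p′ ∈ ps → SameOrder p p′

orderIsomorphic⁺ : ∀ {u v} → length u ≡ length v → SameOrders (zip u v) → OrderIsomorphic u v
orderIsomorphic⁺ len so = len , All.tabulate λ p∈ → All.tabulate λ p′∈ → so p∈ p′∈

orderIsomorphic⁻ : ∀ {u v} → OrderIsomorphic u v → SameOrders (zip u v)
orderIsomorphic⁻ (_ , so) p∈ p′∈ = All.lookup (All.lookup so p∈) p′∈

∈-zip-sym : ∀ (u v : List ℕ) {x y} → (x , y) ∈ zip u v → (y , x) ∈ zip v u
∈-zip-sym (_ ∷ u) (_ ∷ v) (here refl) = here refl
∈-zip-sym (_ ∷ u) (_ ∷ v) (there p∈) = there (∈-zip-sym u v p∈)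

orderIsomorphic-sym : ∀ {u v} → OrderIsomorphic u v → OrderIsomorphic v u
orderIsomorphic-sym {u} {v} oi = orderIsomorphic⁺ (sym (proj₁ oi)) λ p∈ p′∈ →
  sameOrder-sym (orderIsomorphic⁻ oi (∈-zip-sym v u p∈) (∈-zip-sym v u p′∈))

zip-mapʳ : ∀ (f : ℕ → ℕ) (u v : List ℕ) → zip u (map f v) ≡ map (map₂ f) (zip u v)
zip-mapʳ f [] v = refl
zip-mapʳ f (x ∷ u) [] = refl
zip-mapʳ f (x ∷ u) (y ∷ v) = cong (_ ∷_) (zip-mapʳ f u v)

orderIsomorphic-+⁺ : ∀ k u v → OrderIsomorphic u v → OrderIsomorphic u (map (k +_) v)
orderIsomorphic-+⁺ k u v (len , so) = trans len (sym (length-map (k +_) v)) ,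
  subst (λ ps → All (λ p → All (SameOrder p) ps) ps) (sym (zip-mapʳ (k +_) u v))
    (All.map⁺ (All.map (λ so′ → All.map⁺ (All.map (sameOrder-+⁺ k) so′)) so))

orderIsomorphic-+⁻ : ∀ k u v → OrderIsomorphic u (map (k +_) v) → OrderIsomorphic u v
orderIsomorphic-+⁻ k u v (len , so) = trans len (length-map (k +_) v) ,
  All.map (λ so′ → All.map (sameOrder-+⁻ k) (All.map⁻ so′))
    (All.map⁻ (subst (λ ps → All (λ p → All (SameOrder p) ps) ps) (zip-mapʳ (k +_) u v) so))

orderIsomorphic-refl : ∀ u → OrderIsomorphic u u
orderIsomorphic-refl u = orderIsomorphic⁺ refl λ p∈ p′∈ → diag (diagonal u p∈) (diagonal u p′∈)
  where
  diagonal : ∀ u {x y} → (x , y) ∈ zip u u → x ≡ y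
  diagonal (_ ∷ u) (here refl) = refl
  diagonal (_ ∷ u) (there p∈) = diagonal u p∈
  diag : ∀ {x y x′ y′} → x ≡ y → x′ ≡ y′ → SameOrder (x , y) (x′ , y′)
  diag refl refl = (id , id) , (id , id)

-- The letters 1, ..., n seen so far correspond to themselves. An old letter is therefore matched by
-- an equal one, and a new letter must be n + 1 in both words by restricted growth.
growth-rigid : ∀ {n} u v → length u ≡ length v → GrowthFrom n u → GrowthFrom n v →
  (∀ {k p} → 1 ≤ k → k ≤ n → p ∈ zip u v → SameOrder (k , k) p) → SameOrders (zip u v) → u ≡ v
growth-rigid [] [] _ _ _ _ _ = refl
growth-rigid {n} (x ∷ u) (y ∷ v) len gu gv old so = cases (ℕ.m≤n⇒m<n∨m≡n (growth-head gu))
  where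
  cases : x < suc n ⊎ x ≡ suc n → x ∷ u ≡ y ∷ v
  cases (inj₁ (s≤s x≤n)) with refl ← proj₁ (proj₂ (old (proj₁ (gu Fin.zero)) x≤n (here refl))) refl =
    cong (x ∷_) (growth-rigid u v (ℕ.suc-injective len) (growth-pop x≤n gu) (growth-pop x≤n gv)
      (λ 1≤k k≤n p∈ → old 1≤k k≤n (there p∈)) (λ p∈ p′∈ → so (there p∈) (there p′∈)))
  cases (inj₂ refl) with ℕ.m≤n⇒m<n∨m≡n (growth-head gv)
  ... | inj₁ (s≤s y≤n) with refl ← proj₂ (proj₂ (old (proj₁ (gv Fin.zero)) y≤n (here refl))) refl =
    contradiction y≤n ℕ.1+n≰n
  ... | inj₂ refl = cong (x ∷_) (growth-rigid u v (ℕ.suc-injective len) (growth-push gu) (growth-push gv)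
      old′ (λ p∈ p′∈ → so (there p∈) (there p′∈)))
    where
    old′ : ∀ {k p} → 1 ≤ k → k ≤ suc n → p ∈ zip u v → SameOrder (k , k) p
    old′ 1≤k k≤1+n p∈ with ℕ.m≤n⇒m<n∨m≡n k≤1+n
    ... | inj₁ (s≤s k≤n) = old 1≤k k≤n (there p∈)
    ... | inj₂ refl = so (here refl) (there p∈)

orderIsomorphic⇒≡ : ∀ t t′ → OrderIsomorphic (word t) (word t′) → t ≡ t′
orderIsomorphic⇒≡ t t′ oi = word-injective (growth-rigid (word t) (word t′) (proj₁ oi) (growth-word t) (growth-word t′)
  (λ 1≤k k≤0 → contradiction (ℕ.≤-trans 1≤k k≤0) λ ()) (orderIsomorphic⁻ oi))

-- Shifted and concatenated words, and the pattern 1ᵃ (ρ + 1) 1ᵇ.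

enc-++ : ∀ c n t w → enc c n t w ≡ enc c n t [] ++ w
enc-++ c n leaf w = refl
enc-++ c n (node l r) w = cong (c ∷_) (trans (enc-++ (suc n) (suc n) l (enc c (n + blocks l) r w))
  (trans (cong (enc (suc n) (suc n) l [] ++_) (enc-++ c (n + blocks l) r w))
  (trans (sym (++-assoc (enc (suc n) (suc n) l []) _ _))
    (cong (_++ w) (sym (enc-++ (suc n) (suc n) l (enc c (n + blocks l) r [])))))))

map-+-enc : ∀ k {c n c′ n′} t w → c′ ≡ k + c → n′ ≡ k + n →
  map (k +_) (enc c n t w) ≡ enc c′ n′ t (map (k +_) w)
map-+-enc k leaf w _ _ = refl
map-+-enc k {n = n} (node l r) w refl refl = cong (_ ∷_)
  (trans (map-+-enc k l _ (sym (ℕ.+-suc k n)) (sym (ℕ.+-suc k n)))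
    (cong (enc (suc (k + n)) (suc (k + n)) l) (map-+-enc k r w refl (ℕ.+-assoc k n (blocks l)))))

enc-shift : ∀ n t → enc (suc n) (suc n) t [] ≡ map (n +_) (word t)
enc-shift n t = sym (map-+-enc n t [] (ℕ.+-comm 1 n) (ℕ.+-comm 1 n))

word-positive : ∀ t → All (1 ≤_) (word t)
word-positive t = All.tabulate λ x∈ → positive (valid-letters (word-valid t) x∈)
  where
  positive : ∀ {x} → x ∈ [] ⊎ 0 < x → 1 ≤ x
  positive (inj₂ 0<x) = 0<x

shifted-above : ∀ {c n} t → c ≤ n → All (c <_) (enc (suc n) (suc n) t [])
shifted-above {c} {n} t c≤n = subst (All (c <_)) (sym (enc-shift n t))
  (All.map⁺ (All.map (λ 1≤x → ℕ.≤-trans (s≤s c≤n) (ℕ.≤-trans (ℕ.≤-reflexive (ℕ.+-comm 1 n)) (ℕ.+-monoʳ-≤ n 1≤x))) (word-positive t)))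

split-length : ∀ (v {v′} w : List ℕ) → length w ≡ length (v ++ v′) →
  ∃₂ λ u u′ → w ≡ u ++ u′ × length u ≡ length v × length u′ ≡ length v′
split-length [] w eq = [] , w , refl , refl , eq
split-length (_ ∷ v) (x ∷ w) eq with u , u′ , refl , eq₁ , eq₂ ← split-length v w (ℕ.suc-injective eq) =
  x ∷ u , u′ , refl , cong suc eq₁ , eq₂

zip-++ : ∀ (u v {u′ v′} : List ℕ) → length u ≡ length v → zip (u ++ u′) (v ++ v′) ≡ zip u v ++ zip u′ v′
zip-++ [] [] eq = refl
zip-++ (x ∷ u) (y ∷ v) eq = cong (_ ∷_) (zip-++ u v (ℕ.suc-injective eq))

∈-zip-++ˡ : ∀ (u v {u′ v′} : List ℕ) {p} → length u ≡ length v → p ∈ zip u v → p ∈ zip (u ++ u′) (v ++ v′)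
∈-zip-++ˡ u v {u′} {v′} {p} eq p∈ = subst (p ∈_) (sym (zip-++ u v eq)) (∈-++⁺ˡ p∈)

∈-zip-++ʳ : ∀ (u v {u′ v′} : List ℕ) {p} → length u ≡ length v → p ∈ zip u′ v′ → p ∈ zip (u ++ u′) (v ++ v′)
∈-zip-++ʳ u v {u′} {v′} {p} eq p∈ = subst (p ∈_) (sym (zip-++ u v eq)) (∈-++⁺ʳ (zip u v) p∈)

∈-zip-++⁻ : ∀ (u v {u′ v′} : List ℕ) {p} → length u ≡ length v → p ∈ zip (u ++ u′) (v ++ v′) → p ∈ zip u v ⊎ p ∈ zip u′ v′
∈-zip-++⁻ u v {u′} {v′} {p} eq p∈ = ∈-++⁻ (zip u v) (subst (p ∈_) (zip-++ u v eq) p∈)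

sameOrder-<-< : ∀ {x y x′ y′} → x < x′ → y < y′ → SameOrder (x , y) (x′ , y′)
sameOrder-<-< x<x′ y<y′ = ((λ _ → y<y′) , (λ _ → x<x′)) ,
  (λ { refl → contradiction x<x′ (ℕ.<-irrefl refl) }) , (λ { refl → contradiction y<y′ (ℕ.<-irrefl refl) })

sameOrder->-> : ∀ {x y x′ y′} → x′ < x → y′ < y → SameOrder (x , y) (x′ , y′)
sameOrder->-> x>x′ y>y′ =
  ((λ x<x′ → contradiction x<x′ (ℕ.<-asym x>x′)) , (λ y<y′ → contradiction y<y′ (ℕ.<-asym y>y′))) ,
  (λ { refl → contradiction x>x′ (ℕ.<-irrefl refl) }) , (λ { refl → contradiction y>y′ (ℕ.<-irrefl refl) })

sameOrder-≡ : ∀ {x y} → SameOrder (x , y) (x , y)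
sameOrder-≡ {x} {y} = ((λ x<x → contradiction x<x (ℕ.<-irrefl refl)) , (λ y<y → contradiction y<y (ℕ.<-irrefl refl))) ,
  (λ _ → refl) , (λ _ → refl)

all-equal : ∀ {c} k w → length w ≡ length (replicate k 1) →
  (∀ {p} → p ∈ zip w (replicate k 1) → SameOrder (c , 1) p) → w ≡ replicate k c
all-equal zero [] _ _ = refl
all-equal (suc k) (x ∷ w) len so = cong₂ _∷_ (sym (proj₂ (proj₂ (so (here refl))) refl))
  (all-equal k w (ℕ.suc-injective len) (so ∘ there))

all-greater : ∀ {c} u v → length u ≡ length v → All (1 ≤_) v →
  (∀ {p} → p ∈ zip u (map suc v) → SameOrder (c , 1) p) → All (c <_) u
all-greater [] [] _ _ _ = []
all-greater (x ∷ u) (y ∷ v) len (1≤y ∷ 1≤v) so = proj₂ (proj₁ (so (here refl))) (s≤s 1≤y) ∷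
  all-greater u v (ℕ.suc-injective len) 1≤v (so ∘ there)

∈-zip-replicate : ∀ {x y : ℕ} k {p} → p ∈ zip (replicate k x) (replicate k y) → p ≡ (x , y)
∈-zip-replicate (suc k) (here refl) = refl
∈-zip-replicate (suc k) (there p∈) = ∈-zip-replicate k p∈

∈-zip-positive : ∀ {c} u v {p} → All (c <_) u → All (1 ≤_) v → p ∈ zip u (map suc v) →
  ∃₂ λ x y → p ≡ (x , suc y) × c < x × 1 ≤ y
∈-zip-positive (x ∷ u) (y ∷ v) (c<x ∷ _) (1≤y ∷ _) (here refl) = x , y , refl , c<x , 1≤y
∈-zip-positive (x ∷ u) (y ∷ v) (_ ∷ c<) (_ ∷ 1≤) (there p∈) = ∈-zip-positive u v c< 1≤ p∈

take-length-++ : ∀ (u v : List ℕ) {w} → length u ≡ length v → take (length v) (u ++ w) ≡ u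
take-length-++ [] [] eq = refl
take-length-++ (x ∷ u) (y ∷ v) eq = cong (x ∷_) (take-length-++ u v (ℕ.suc-injective eq))

pattern-word : ℕ → ℕ → List ℕ → List ℕ
pattern-word a b ρ = replicate a 1 ++ map suc ρ ++ replicate b 1

module _ (a′ b : ℕ) (ρ : List ℕ) (ρ-positive : All (1 ≤_) ρ) where

  private
    a = suc a′
    τ = pattern-word a b ρ

    length-replicate-≡ : ∀ k {x y : ℕ} → length (replicate k x) ≡ length (replicate k y)
    length-replicate-≡ k = trans (length-replicate k) (sym (length-replicate k))

  -- Every letter is compared with the first pair (c, 1): letters opposite a 1 equal c, and letters
  -- opposite `map suc ρ` exceed c because `ρ` is positive.
  occurrence⁻ : ∀ {c w} → OrderIsomorphic (c ∷ w) τ →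
    ∃ λ u → c ∷ w ≡ replicate a c ++ u ++ replicate b c × All (c <_) u × OrderIsomorphic u ρ
  occurrence⁻ {c} {w} oi
    with w₁ , w′ , eq , len₁ , len′ ← split-length (replicate a 1) (c ∷ w) (proj₁ oi)
    with w₂ , w₃ , refl , len₂ , len₃ ← split-length (map suc ρ) w′ len′
    = w₂
    , trans eq (cong₂ _++_ w₁≡ (cong (w₂ ++_) w₃≡))
    , all-greater w₂ ρ len₂′ ρ-positive (so₁ ∘ in₂)
    , orderIsomorphic-+⁻ 1 w₂ ρ (orderIsomorphic⁺ len₂ λ p∈ p′∈ → so (in₂ p∈) (in₂ p′∈))
    where
    len₂′ = trans len₂ (length-map suc ρ)
    so : SameOrders (zip (w₁ ++ w₂ ++ w₃) τ)
    so = subst (λ w → SameOrders (zip w τ)) eq (orderIsomorphic⁻ oi)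
    so₁ : ∀ {p} → p ∈ zip (w₁ ++ w₂ ++ w₃) τ → SameOrder (c , 1) p
    so₁ = so (subst (λ w → (c , 1) ∈ zip w τ) eq (here refl))
    in₂ : ∀ {p} → p ∈ zip w₂ (map suc ρ) → p ∈ zip (w₁ ++ w₂ ++ w₃) τ
    in₂ = ∈-zip-++ʳ w₁ (replicate a 1) len₁ ∘ ∈-zip-++ˡ w₂ (map suc ρ) len₂
    w₁≡ = all-equal a w₁ len₁ (so₁ ∘ ∈-zip-++ˡ w₁ (replicate a 1) len₁)
    w₃≡ = all-equal b w₃ len₃ (so₁ ∘ ∈-zip-++ʳ w₁ (replicate a 1) len₁ ∘ ∈-zip-++ʳ w₂ (map suc ρ) len₂)

  occurrence⁺ : ∀ {c} u → All (c <_) u → OrderIsomorphic u ρ →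
    OrderIsomorphic (replicate a c ++ u ++ replicate b c) τ
  occurrence⁺ {c} u c<u oi = orderIsomorphic⁺ lengths so
    where
    len₁ : length (replicate a c) ≡ length (replicate a 1)
    len₁ = length-replicate-≡ a
    len₂ : length u ≡ length (map suc ρ)
    len₂ = trans (proj₁ oi) (sym (length-map suc ρ))

    lengths : length (replicate a c ++ u ++ replicate b c) ≡ length τ
    lengths = trans (length-++ (replicate a c)) (trans (cong₂ _+_ len₁
      (trans (length-++ u) (trans (cong₂ _+_ len₂ (length-replicate-≡ b)) (sym (length-++ (map suc ρ))))))
      (sym (length-++ (replicate a 1))))

    kind : ∀ {p} → p ∈ zip (replicate a c ++ u ++ replicate b c) τ → p ≡ (c , 1) ⊎ p ∈ zip u (map suc ρ)
    kind p∈ with ∈-zip-++⁻ (replicate a c) (replicate a 1) len₁ p∈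
    ... | inj₁ p∈₁ = inj₁ (∈-zip-replicate a p∈₁)
    ... | inj₂ p∈₂₃ with ∈-zip-++⁻ u (map suc ρ) len₂ p∈₂₃
    ...   | inj₁ p∈₂ = inj₂ p∈₂
    ...   | inj₂ p∈₃ = inj₁ (∈-zip-replicate b p∈₃)

    so : SameOrders (zip (replicate a c ++ u ++ replicate b c) τ)
    so p∈ p′∈ with kind p∈ | kind p′∈
    ... | inj₁ refl | inj₁ refl = sameOrder-≡
    ... | inj₂ q | inj₂ q′ = orderIsomorphic⁻ (orderIsomorphic-+⁺ 1 u ρ oi) q q′
    ... | inj₁ refl | inj₂ q′ with x , y , refl , c<x , 1≤y ← ∈-zip-positive u ρ c<u ρ-positive q′ =
      sameOrder-<-< c<x (s≤s 1≤y)
    ... | inj₂ q | inj₁ refl with x , y , refl , c<x , 1≤y ← ∈-zip-positive u ρ c<u ρ-positive q =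
      sameOrder->-> c<x (s≤s 1≤y)

Head-≤ : ∀ {c n z} r → c ≤ n → Head (_< c) z → Head (_≤ c) (enc c n r z)
Head-≤ {c} {n} {z} r c≤n hz = head-enc n r z ℕ.≤-refl (map-head ℕ.<⇒≤ z hz)

-- The cut is the first place at which a letter does not exceed c, or the end of the word.
++-unique : ∀ {c} (u v {w w′} : List ℕ) → All (c <_) u → All (c <_) v → Head (_≤ c) w → Head (_≤ c) w′ →
  u ++ w ≡ v ++ w′ → u ≡ v × w ≡ w′
++-unique [] [] _ _ _ _ eq = refl , eq
++-unique [] (x ∷ v) {y ∷ w} _ (c<x ∷ _) y≤c _ refl = contradiction c<x (ℕ.≤⇒≯ y≤c)
++-unique (x ∷ u) [] {w′ = y ∷ w′} (c<x ∷ _) _ _ y≤c refl = contradiction c<x (ℕ.≤⇒≯ y≤c)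
++-unique (x ∷ u) (y ∷ v) (_ ∷ c<u) (_ ∷ c<v) hw hw′ eq with refl , eq′ ← ∷-injective eq
  with refl , w≡ ← ++-unique u v c<u c<v hw hw′ eq′ = refl , w≡

-- Occurrences in words against shapes of trees.

module Occurrence (a′ b′ : ℕ) (ρ : Tree) where

  open Shape a′ b′ ρ

  τ : List ℕ
  τ = pattern-word (suc a′) (suc b′) (word ρ)

  -- The letter after the tree is below c, so the run cannot leave the tree; a nonempty gap would
  -- put the label n + 1, which exceeds c, into the run.
  tailShape⁺ : ∀ {c n z} k t {v} → c ≤ n → Head (_< c) z →
    enc c n t z ≡ replicate (suc k) c ++ v → tailShape k t ≡ true
  tailShape⁺ k leaf c≤n hz refl = contradiction hz (ℕ.<-irrefl refl)
  tailShape⁺ zero (node l r) c≤n hz eq = refl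
  tailShape⁺ (suc k) (node leaf r) c≤n hz eq =
    tailShape⁺ k r (ℕ.m≤n⇒m≤n+o 0 c≤n) hz (∷-injectiveʳ eq)
  tailShape⁺ (suc k) (node (node _ _) r) c≤n hz eq =
    contradiction c≤n (subst (λ c → ¬ c ≤ _) (∷-injectiveˡ (∷-injectiveʳ eq)) ℕ.1+n≰n)

  tailShape⁻ : ∀ {c n z} k t → tailShape k t ≡ true → ∃ λ v → enc c n t z ≡ replicate (suc k) c ++ v
  tailShape⁻ zero (node l r) eq = _ , refl
  tailShape⁻ {c} (suc k) (node leaf r) eq with v , eq′ ← tailShape⁻ k r eq = v , cong (c ∷_) eq′

  -- At k = 0 the maximal stretch of letters above c after the first letter is the shifted word of
  -- the left child. It is order-isomorphic to the word of `ρ`, and rigidity of restricted growth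
  -- makes the two trees equal.
  shape⁺ : ∀ {c n z} k t {u v} → c ≤ n → Head (_< c) z → All (c <_) u → OrderIsomorphic u (word ρ) →
    enc c n t z ≡ replicate (suc k) c ++ u ++ replicate (suc b′) c ++ v → shape k t ≡ true
  shape⁺ k leaf c≤n hz c<u oi refl = contradiction hz (ℕ.<-irrefl refl)
  shape⁺ {c} {n} {z} zero (node l r) {u} {v} c≤n hz c<u oi eq
    with refl , rest ← ++-unique (enc (suc n) (suc n) l []) u (shifted-above l c≤n) c<u
           (Head-≤ r (ℕ.m≤n⇒m≤n+o (blocks l) c≤n) hz) ℕ.≤-refl
           (trans (sym (enc-++ (suc n) (suc n) l (enc c (n + blocks l) r z))) (∷-injectiveʳ eq))
    with refl ← orderIsomorphic⇒≡ ρ l (orderIsomorphic-+⁻ n (word ρ) (word l)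
           (subst (OrderIsomorphic (word ρ)) (enc-shift n l) (orderIsomorphic-sym oi)))
    = cong₂ _∧_ (same-refl ρ) (tailShape⁺ b′ r (ℕ.m≤n⇒m≤n+o (blocks l) c≤n) hz rest)
  shape⁺ (suc k) (node leaf r) c≤n hz c<u oi eq =
    shape⁺ k r (ℕ.m≤n⇒m≤n+o 0 c≤n) hz c<u oi (∷-injectiveʳ eq)
  shape⁺ (suc k) (node (node _ _) r) c≤n hz c<u oi eq =
    contradiction c≤n (subst (λ c → ¬ c ≤ _) (∷-injectiveˡ (∷-injectiveʳ eq)) ℕ.1+n≰n)

  shape⁻ : ∀ {c n z} k t → c ≤ n → shape k t ≡ true →
    ∃₂ λ u v → All (c <_) u × OrderIsomorphic u (word ρ) ×
      enc c n t z ≡ replicate (suc k) c ++ u ++ replicate (suc b′) c ++ v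
  shape⁻ {c} {n} {z} zero (node l r) c≤n eq with same ρ l in eqˡ
  ... | true with refl ← same⇒≡ ρ l eqˡ with v , eq′ ← tailShape⁻ {c} {n + blocks l} {z} b′ r eq =
    enc (suc n) (suc n) l [] , v , shifted-above l c≤n ,
    orderIsomorphic-sym (subst (OrderIsomorphic (word l)) (sym (enc-shift n l))
      (orderIsomorphic-+⁺ n (word l) (word l) (orderIsomorphic-refl (word l)))) ,
    cong (c ∷_) (trans (enc-++ (suc n) (suc n) l _) (cong (enc (suc n) (suc n) l [] ++_) eq′))
  shape⁻ {c} {n} {z} (suc k) (node leaf r) c≤n eq
    with u , v , c<u , oi , eq′ ← shape⁻ {c} {n + 0} {z} k r (ℕ.m≤n⇒m≤n+o 0 c≤n) eq =
    u , v , c<u , oi , cong (c ∷_) eq′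

  occursAtHead : List ℕ → Bool
  occursAtHead σ = does (orderIsomorphic? (take (length τ) σ) τ)

  occursAtHead-enc : ∀ {c n z} l r → c ≤ n → Head (_< c) z →
    occursAtHead (enc c n (node l r) z) ≡ shape a′ (node l r)
  occursAtHead-enc {c} {n} {z} l r c≤n hz with shape a′ (node l r) in eq
  ... | true with u , v , c<u , oi , enc≡ ← shape⁻ {c} {n} {z} a′ (node l r) c≤n eq =
    dec-true (orderIsomorphic? _ τ) (subst (λ w → OrderIsomorphic w τ) (sym prefix) oi′)
    where
    oi′ = occurrence⁺ a′ (suc b′) (word ρ) (word-positive ρ) u c<u oi
    prefix : take (length τ) (enc c n (node l r) z) ≡ replicate (suc a′) c ++ u ++ replicate (suc b′) c
    prefix = trans (cong (take (length τ)) (trans enc≡ (sym (trans (++-assoc (replicate (suc a′) c) _ v)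
        (cong (replicate (suc a′) c ++_) (++-assoc u _ v))))))
      (take-length-++ _ τ (proj₁ oi′))
  ... | false = dec-false (orderIsomorphic? _ τ) λ oi →
    let u , w≡ , c<u , oi′ = occurrence⁻ a′ (suc b′) (word ρ) (word-positive ρ) oi
        σ = enc c n (node l r) z
        enc≡ = trans (sym (take++drop≡id (length τ) σ)) (trans (cong (_++ drop (length τ) σ) w≡)
          (trans (++-assoc (replicate (suc a′) c) _ _) (cong (replicate (suc a′) c ++_) (++-assoc u _ _))))
    in contradiction (trans (sym eq) (shape⁺ a′ (node l r) c≤n hz c<u oi′ enc≡)) λ ()

  indicator : Bool → ℕ
  indicator b = if b then 1 else 0

  -- Counts along suffixes instead of start indices, to match the recursion of `enc`.
  count : List ℕ → ℕ
  count [] = 0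
  count (x ∷ σ) = indicator (occursAtHead (x ∷ σ)) + count σ

  length-filter-applyUpTo : ∀ {P : ℕ → Set} (P? : ∀ i → Dec (P i)) f n →
    length (filter P? (applyUpTo f (suc n))) ≡ indicator (does (P? (f 0))) + length (filter P? (applyUpTo (f ∘ suc) n))
  length-filter-applyUpTo P? f n with does (P? (f 0))
  ... | true = refl
  ... | false = refl

  length-filter-suc : ∀ {P Q : ℕ → Set} (P? : ∀ i → Dec (P i)) (Q? : ∀ i → Dec (Q i)) →
    (∀ i → does (P? (suc i)) ≡ does (Q? i)) → ∀ f n →
    length (filter P? (applyUpTo (suc ∘ f) n)) ≡ length (filter Q? (applyUpTo f n))
  length-filter-suc P? Q? P≡Q f zero = refl
  length-filter-suc P? Q? P≡Q f (suc n) = trans (length-filter-applyUpTo P? (suc ∘ f) n)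
    (trans (cong₂ (λ b k → indicator b + k) (P≡Q (f 0)) (length-filter-suc P? Q? P≡Q (f ∘ suc) n))
      (sym (length-filter-applyUpTo Q? f n)))

  occurs? : ∀ σ i → Dec (OrderIsomorphic (take (length τ) (drop i σ)) τ)
  occurs? σ i = orderIsomorphic? (take (length τ) (drop i σ)) τ

  -- One less than the length of `τ`; naming it lets the truncated subtraction in `μ` reduce by a
  -- successor on both sides.
  k : ℕ
  k = length (replicate a′ 1 ++ map suc (word ρ) ++ replicate (suc b′) 1)

  μ≡count : ∀ σ → μ τ σ ≡ count σ
  μ≡count [] = cong (λ n → length (filter (occurs? []) (upTo n))) (ℕ.0∸n≡0 k)
  μ≡count (x ∷ σ) with k ℕ.≤? length σ
  ... | yes k≤σ = trans
    (cong (λ n → length (filter (occurs? (x ∷ σ)) (upTo n))) (ℕ.+-∸-assoc 1 k≤σ))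
    (trans (length-filter-applyUpTo (occurs? (x ∷ σ)) id (length σ ∸ k))
      (cong (indicator (occursAtHead (x ∷ σ)) +_)
        (trans (length-filter-suc (occurs? (x ∷ σ)) (occurs? σ) (λ _ → refl) id (length σ ∸ k)) (μ≡count σ))))
  -- The word is too short: `μ` has no start index left, and in `count` the truncated window differs
  -- from `τ` in length.
  ... | no k≰σ = trans (cong (λ n → length (filter (occurs? (x ∷ σ)) (upTo n))) (ℕ.m≤n⇒m∸n≡0 (ℕ.≰⇒> k≰σ)))
    (sym (cong₂ (λ b n → indicator b + n)
      (dec-false (occurs? (x ∷ σ) 0) λ oi → k≰σ (ℕ.≤-trans (ℕ.≤-reflexive (sym (ℕ.suc-injective (proj₁ oi))))
        (subst (_≤ length σ) (sym (length-take k σ)) (ℕ.m⊓n≤n k (length σ)))))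
      (trans (sym (μ≡count σ))
        (cong (λ n → length (filter (occurs? σ) (upTo n))) (ℕ.m≤n⇒m∸n≡0 (ℕ.<⇒≤ (ℕ.≰⇒> k≰σ)))))))

  -- The letter after an encoded tree is below its first label, and likewise the letter after the
  -- gap `l` is below the label n + 1. So occurrences in the gap and in the continuation are counted
  -- independently.
  count-enc : ∀ {c n z} t → c ≤ n → Head (_< c) z → count (enc c n t z) ≡ occ t + count z
  count-enc leaf _ _ = refl
  count-enc {c} {n} {z} (node l r) c≤n hz = trans
    (cong₂ (λ b m → indicator b + m) (occursAtHead-enc l r c≤n hz)
      (trans (count-enc l ℕ.≤-refl (map-head {_≤ c} {_< suc n} (λ x≤c → s≤s (ℕ.≤-trans x≤c c≤n)) (enc c (n + blocks l) r z) (Head-≤ {c} {n + blocks l} {z} r c≤n′ hz)))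
        (trans (cong (occ l +_) (count-enc r c≤n′ hz)) (sym (ℕ.+-assoc (occ l) (occ r) (count z))))))
    (sym (ℕ.+-assoc (indicator (shape a′ (node l r))) (occ l + occ r) (count z)))
    where
    c≤n′ = ℕ.m≤n⇒m≤n+o (blocks l) c≤n

  μ-word : ∀ t → μ τ (word t) ≡ occ t
  μ-word t = trans (μ≡count (word t)) (trans (count-enc t ℕ.≤-refl tt) (ℕ.+-identityʳ (occ t)))

-- Transfer from trees to non-crossing partitions.

isNode-nonempty : ∀ t → 1 ≤ size t → isNode t ≡ true
isNode-nonempty (node _ _) _ = refl

record IsRingWith2≉0 {c ℓ} (K : RawRing c ℓ) : Set (c ⊔ˡ ℓ) where
  open RawRing K renaming (_+_ to _+ᴷ_)
  field
    isCommutativeRing : IsCommutativeRing _≈_ _+ᴷ_ _*_ -_ 0# 1#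
    2≉0 : 1# +ᴷ 1# ≉ 0#

module NonCrossingSeries {c ℓ} {K : RawRing c ℓ} (K-ring : IsRingWith2≉0 K) (q : RawRing.Carrier K) where

  open IsRingWith2≉0 K-ring
  private
    R : CommutativeRing c ℓ
    R = record { isCommutativeRing = isCommutativeRing }
    module R = CommutativeRing R
    module S = CommutativeRing (SeriesRing.commutativeRing R)
  open PowerSeries K
  open ClosedForm K q
  open TreeSum R using (total; total-↭; total-map; gf)
  open RawSemiringDefinitions (RawRing.rawSemiring K) using () renaming (_^_ to _^ᴷ_)

  gfNC : List ℕ → Series
  gfNC τ n = total (λ π → q ^ᴷ μ τ π) (NC n)

  isQuotient-≈ : ∀ {f f′} g h → f ≈ f′ → IsQuotient f′ g h → IsQuotient f g h
  isQuotient-≈ {f} g h f≈f′ (h≉0 , f′h≈g) = h≉0 , λ n → R.trans (S.*-congʳ {h} f≈f′ n) (f′h≈g n)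

  hasClosedForm-≈ : ∀ a b m f g → f ≈ g → HasClosedForm a b m g → HasClosedForm a b m f
  hasClosedForm-≈ a b m f g f≈g (ratio , root , ratio-eq , root-eq , quotient) =
    ratio , root , ratio-eq , root-eq , isQuotient-≈ {f} {g} _ _ f≈g quotient

  module _ (a′ b′ : ℕ) (t : Tree) (isNode-t : isNode t ≡ true) where

    open Occurrence a′ b′ t using (τ; μ-word)
    open Weights R q (R.1# R.- q) (Elimination.minus-plus R R.1# q) a′ b′ t isNode-t using (weight)

    gfNC≈gf : gfNC τ ≈ gf weight
    gfNC≈gf n = R.trans (total-↭ (λ π → q ^ᴷ μ τ π) (NC↭words n))
      (total-map word (λ t → R.reflexive (cong (q ^ᴷ_) (μ-word t))) (trees n))

    closedForm-word : HasClosedForm (suc a′) (suc b′) (size t) (gfNC τ)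
    closedForm-word = hasClosedForm-≈ (suc a′) (suc b′) (size t) (gfNC τ) (gf weight) gfNC≈gf
      (Telescope.closedForm R q a′ b′ t isNode-t 2≉0)

  -- The series is a parameter compared with `gfNC` coefficient by coefficient, so that the
  -- conclusion can speak of `generatingFunction` under its own name.
  closedForm : (f : List ℕ → Series) → (∀ τ n → f τ n ≡ gfNC τ n) →
    (a b m : ℕ) (ρ : List ℕ) → 1 ≤ a → 1 ≤ b → 1 ≤ m → IsNC m ρ →
    HasClosedForm a b m (f (pattern-word a b ρ))
  closedForm f f≡ (suc a′) (suc b′) m ρ _ _ 1≤m ρ-NC = fromTree (isNC⇒word ρ-NC) 1≤m
    where
    fromTree : ∀ {m ρ} → (∃ λ t → size t ≡ m × word t ≡ ρ) → 1 ≤ m →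
      HasClosedForm (suc a′) (suc b′) m (f (pattern-word (suc a′) (suc b′) ρ))
    fromTree (t , refl , refl) 1≤m = hasClosedForm-≈ (suc a′) (suc b′) (size t) (f τ) (gfNC τ)
      (λ n → R.reflexive (f≡ τ n))
      (closedForm-word a′ b′ t (isNode-nonempty t 1≤m))
      where τ = pattern-word (suc a′) (suc b′) (word t)

ℚ⟨q⟩-isRingWith2≉0 : IsRingWith2≉0 ℚ⟨q⟩
ℚ⟨q⟩-isRingWith2≉0 = record
  { isCommutativeRing = CommutativeRing.isCommutativeRing ℚ⟨q⟩-commutativeRing
  ; 2≉0 = λ 2≈0 → case 2≈0 0 of λ ()
  }

-- Conversion between expressions over the concrete ℚ⟨q⟩ unfolds all fraction and
-- polynomial arithmetic, which is infeasible.  Hence ClosedForm states the formula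
-- over an arbitrary K, and K is inferred here from the type of ℚ⟨q⟩-isRingWith2≉0,
-- so that the two types agree syntactically.
theorem6 : (a b m : ℕ) (ρ : List ℕ) →
    1 ≤ a → 1 ≤ b → 1 ≤ m → IsNC m ρ →
    let open ClosedForm ℚ⟨q⟩ q
        τ = replicate a 1 ++ map suc ρ ++ replicate b 1
    in HasClosedForm a b m (generatingFunction τ)
theorem6 = NonCrossingSeries.closedForm ℚ⟨q⟩-isRingWith2≉0 q generatingFunction (λ _ _ → refl)
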